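{- For every positive integer $k$ and every set $X$ with $|X|\ge k^2+k$ there exists an oversaturated $k$-Sperner system $\mathcal{F}\subseteq\mathcal{P}(X)$ with $|\mathcal{F}|=O\left(k^5 2^{k/2}\right)$ (the implied constant being absolute). In particular, $\operatorname{osat}(k)=2^{(1/2+o(1))k}$.
   Context: For a set $X$ and $\mathcal{F}\subseteq\mathcal{P}(X)$, a $(k+1)$-chain in $\mathcal{F}$ is a collection of sets $A_1\subsetneq\dots\subsetneq A_{k+1}$ all in $\mathcal{F}$. $\mathcal{F}$ is an oversaturated $k$-Sperner system if for every $S\in\mathcal{P}(X)\setminus\mathcal{F}$, the number of $(k+1)$-chains in $\mathcal{F}\cup\{S\}$ is greater than the number of $(k+1)$-chains in $\mathcal{F}$. $\operatorname{osat}(n,k)$ is the minimum size of an oversaturated $k$-Sperner system in $\mathcal{P}(X)$ with $|X|=n$; for fixed $k$ it is constant for all sufficiently large $n$, and $\operatorname{osat}(k):=\lim_{n\to\infty}\operatorname{osat}(n,k)$. -}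

module Defs where

open import Data.Nat using (ℕ; zero; suc; _<_)
open import Data.List using (List; _∷_; map; filter)
open import Data.Nat.ListAction using (sum)
open import Data.List.Membership.Propositional using (_∉_)
open import Data.List.Relation.Unary.Unique.Propositional using (Unique)
open import Data.Fin.Subset using (Subset)
open import Data.Fin.Subset.Properties using (_⊂?_)
open import Data.Product using (_×_)

-- A family 𝓕 ⊆ 𝓟(X), X = Fin n, is represented by a duplicate-free list of subsets
-- (see `Family` below); its size is the length of the list.

-- chainsEnding 𝓕 j A = number of sequences B₁ ⊊ B₂ ⊊ … ⊊ B_{j+1} = A with all Bᵢ ∈ 𝓕
-- (A itself is not required to be in 𝓕 here; it is only called on members).
chainsEnding : {n : ℕ} → List (Subset n) → ℕ → Subset n → ℕ
chainsEnding 𝓕 zero    A = 1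
chainsEnding 𝓕 (suc j) A = sum (map (chainsEnding 𝓕 j) (filter (λ B → B ⊂? A) 𝓕))

-- Number of (k+1)-chains A₁ ⊊ … ⊊ A_{k+1} in 𝓕 (for duplicate-free 𝓕, each chain,
-- viewed as a collection of sets, corresponds to exactly one such increasing sequence).
chainCount : {n : ℕ} → ℕ → List (Subset n) → ℕ
chainCount k 𝓕 = sum (map (chainsEnding 𝓕 k) 𝓕)

Oversaturated : {n : ℕ} → ℕ → List (Subset n) → Set
Oversaturated k 𝓕 = ∀ S → S ∉ 𝓕 → chainCount k 𝓕 < chainCount k (S ∷ 𝓕)

OsatFamily : (n k : ℕ) → List (Subset n) → Set
OsatFamily n k 𝓕 = Unique 𝓕 × Oversaturated k 𝓕

{-# OPTIONS --safe #-}
module Submission where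

-- Lower bound.  If 𝓕 is oversaturated, every S has 𝓕-chains below and above it of total length k,
-- so S contains a member of size at least about k / 2 or is contained in a member missing at least
-- about k / 2 points.  Each member does this only for about a
-- 2 ^ (- k / 2) fraction of all S.
--
-- Upper bound.  With κ = k − 1, fix a core of κ (κ + 2) points.  For each a ≤ κ a greedy choice of
-- about k² 2 ^ (k / 2) injective sequences of length a in the core hits every trace S that contains
-- at least a 2 ^ (- k / 2) fraction (up to a constant) of all sequences; the suffixes of a chosen
-- sequence form a chain of a + 1 sets.  The family consists of these sets and their complements.
-- If S has density p in the core and q = 1 − p, then a with p ^ a ≥ 2 ^ (- κ / 2) and b with
-- q ^ b ≥ 2 ^ (- κ / 2) can be chosen with a + b ≥ κ − 1: otherwise p ^ α and q ^ β would both be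
-- below 2 ^ (- κ / 2) for some α + β = κ, which weighted AM–GM excludes.

open import Defs
open import Data.Bool using (if_then_else_; not)
open import Data.Bool.Properties using (_≟_; not-involutive)
open import Data.Empty using (⊥; ⊥-elim)
open import Data.Fin using (Fin; zero; suc; inject≤)
import Data.Fin.Properties as Fin
open import Data.Fin.Subset as Sub using (Subset; inside; outside; ∣_∣; _-_; _⊂_; _⊆_; ⁅_⁆; _∪_; ∁)
open import Data.Fin.Subset.Properties
open import Data.List using (List; []; _∷_; _++_; map; length; filter; concatMap; deduplicate; tabulate; allFin; cartesianProductWith)
open import Data.List.Membership.Propositional using (_∈_; _∉_; lose)
open import Data.List.Membership.Propositional.Properties using (∈-filter⁺; ∈-filter⁻; ∈-++⁺ˡ; ∈-++⁺ʳ; ∈-map⁺; ∈-concatMap⁺; ∈-cartesianProductWith⁻; ∈-deduplicate⁺)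
import Data.List.Membership.DecPropositional as DecMembership
open import Data.List.Properties using (map-++; map-∘; map-cong; map-tabulate; length-tabulate; length-map; length-++; length-filter; length-deduplicate; filter-accept)
open import Data.List.Relation.Unary.Any using (here; there)
import Data.List.Relation.Unary.Unique.DecPropositional.Properties as Unique
open import Data.Nat hiding (∣_-_∣; _≟_)
open import Data.Nat.ListAction using (sum)
open import Data.Nat.ListAction.Properties using (sum-++)
open import Data.Nat.Properties hiding (_≟_)
open import Data.Nat.Tactic.RingSolver using (solve-∀)
open import Data.Product using (_×_; Σ; ∃; ∃-syntax; _,_; proj₁; proj₂)
open import Data.Sum using (_⊎_; inj₁; inj₂)
open import Data.Unit using (⊤; tt)
open import Data.Vec as Vec using ([]; _∷_; here; there)
open import Data.Vec.Properties as Vec using (≡-dec; []=⇒lookup; lookup⇒[]=; lookup∘tabulate; tabulate-cong; tabulate-∘; lookup-map)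
open import Function using (_∘_)
open import Relation.Binary using (DecidableEquality)
open import Relation.Binary.PropositionalEquality
open import Relation.Nullary using (Dec; yes; no; does; ¬?; _×-dec_)


-- Young's inequality and weighted AM-GM over the natural numbers.

^-distribʳ-* : ∀ n a b → (a * b) ^ n ≡ a ^ n * b ^ n
^-distribʳ-* zero    a b = refl
^-distribʳ-* (suc n) a b rewrite ^-distribʳ-* n a b = lem a b (a ^ n) (b ^ n)
  where
  lem : ∀ a b x y → a * b * (x * y) ≡ a * x * (b * y)
  lem = solve-∀

square-cancel-≤ : ∀ {m n} → m * m ≤ n * n → m ≤ n
square-cancel-≤ {m} {n} mm≤nn = ≮⇒≥ λ n<m → <⇒≱ (*-mono-< n<m n<m) mm≤nn

2mn≤m²+n² : ∀ m n → 2 * (m * n) ≤ m * m + n * n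
2mn≤m²+n² m n with ≤-total m n
... | inj₁ m≤n with d , refl ← m≤n⇒∃[o]m+o≡n m≤n =
  ≤-trans (m≤m+n _ (d * d)) (≤-reflexive (lem m d))
  where
  lem : ∀ m d → 2 * (m * (m + d)) + d * d ≡ m * m + (m + d) * (m + d)
  lem = solve-∀
... | inj₂ n≤m with d , refl ← m≤n⇒∃[o]m+o≡n n≤m =
  ≤-trans (m≤m+n _ (d * d)) (≤-reflexive (lem n d))
  where
  lem : ∀ n d → 2 * ((n + d) * n) + d * d ≡ (n + d) * (n + d) + n * n
  lem = solve-∀

-- The tangent line to the convex function m ^ (n + 1) at `a`, with the negative term moved across.
-- The induction step multiplies the hypothesis by `m` and splits a mixed term by 2am ≤ a² + m².
young : ∀ n a m → suc n * a ^ n * m ≤ m ^ suc n + n * a ^ suc n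
young zero    a m = ≤-reflexive (lem m)
  where
  lem : ∀ m → 1 * 1 * m ≡ m * 1 + 0
  lem = solve-∀
young (suc n) a m = +-cancelʳ-≤ (n * (a * P) * m) _ _ (begin
  (2 + n) * (a * P) * m + n * (a * P) * m
    ≡⟨ lem₁ n a m P ⟩
  suc n * P * (2 * (a * m))
    ≤⟨ *-monoʳ-≤ (suc n * P) (2mn≤m²+n² a m) ⟩
  suc n * P * (a * a + m * m)
    ≡⟨ lem₂ n a m P ⟩
  suc n * P * m * m + suc n * (a * (a * P))
    ≤⟨ +-monoˡ-≤ _ (*-monoˡ-≤ m (young n a m)) ⟩
  (Q + n * (a * P)) * m + suc n * (a * (a * P))
    ≡⟨ lem₃ n a m P Q ⟩
  m * Q + suc n * (a * (a * P)) + n * (a * P) * m ∎)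
  where
  open ≤-Reasoning
  P = a ^ n
  Q = m ^ suc n
  lem₁ : ∀ n a m P → (2 + n) * (a * P) * m + n * (a * P) * m ≡ suc n * P * (2 * (a * m))
  lem₁ = solve-∀
  lem₂ : ∀ n a m P → suc n * P * (a * a + m * m) ≡ suc n * P * m * m + suc n * (a * (a * P))
  lem₂ = solve-∀
  lem₃ : ∀ n a m P Q → (Q + n * (a * P)) * m + suc n * (a * (a * P))
                     ≡ m * Q + suc n * (a * (a * P)) + n * (a * P) * m
  lem₃ = solve-∀

-- AM–GM for n copies of A / n and one copy of D.
am-gm-step : ∀ n .{{_ : NonZero n}} A D →
             A ^ n * suc n ^ suc n * D ≤ (A + D) ^ suc n * n ^ n
am-gm-step n A D = *-cancelˡ-≤ n (+-cancelʳ-≤ (n * (suc n * A * (U * P))) _ _ (begin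
  n * (P * (suc n * U) * D) + n * (suc n * A * (U * P))
    ≡⟨ lem₁ n A D P U ⟩
  suc n * (U * P) * (n * (A + D))
    ≡⟨ cong (λ z → suc n * z * (n * (A + D))) (^-distribʳ-* n (suc n) A) ⟨
  suc n * (suc n * A) ^ n * (n * (A + D))
    ≤⟨ young n (suc n * A) (n * (A + D)) ⟩
  (n * (A + D)) ^ suc n + n * (suc n * A) ^ suc n
    ≡⟨ cong₂ (λ y z → y + n * (suc n * A * z)) (^-distribʳ-* (suc n) n (A + D)) (^-distribʳ-* n (suc n) A) ⟩
  n * V * W + n * (suc n * A * (U * P))
    ≡⟨ cong (_+ n * (suc n * A * (U * P))) (lem₂ n V W) ⟩
  n * (W * V) + n * (suc n * A * (U * P)) ∎))
  where
  open ≤-Reasoning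
  P = A ^ n
  U = suc n ^ n
  V = n ^ n
  W = (A + D) ^ suc n
  lem₁ : ∀ n A D P U → n * (P * (suc n * U) * D) + n * (suc n * A * (U * P))
                     ≡ suc n * (U * P) * (n * (A + D))
  lem₁ = solve-∀
  lem₂ : ∀ n V W → n * V * W ≡ n * (W * V)
  lem₂ = solve-∀

-- Induction on `γ`: one more copy of `Z` is `am-gm-step`, with the sum of the earlier β terms as
-- `A`. With no copy of `Z` there is equality.
weighted-am-gm : ∀ γ α .{{_ : NonZero α}} Y Z →
                 (γ + α) ^ (γ + α) * (Y ^ α * Z ^ γ) ≤ (γ * Z + α * Y) ^ (γ + α)
weighted-am-gm zero α Y Z =
  ≤-reflexive (trans (cong (α ^ α *_) (*-identityʳ (Y ^ α))) (sym (^-distribʳ-* α α Y)))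
weighted-am-gm (suc γ) α Y Z = *-cancelʳ-≤ _ _ (β ^ β) {{m^n≢0 β β}} (begin
  suc β ^ suc β * (Y ^ α * (Z * Z ^ γ)) * β ^ β
    ≡⟨ lem₁ (suc β ^ suc β) (Y ^ α) Z (Z ^ γ) (β ^ β) ⟩
  β ^ β * (Y ^ α * Z ^ γ) * (suc β ^ suc β * Z)
    ≤⟨ *-monoˡ-≤ (suc β ^ suc β * Z) (weighted-am-gm γ α Y Z) ⟩
  A ^ β * (suc β ^ suc β * Z)
    ≡⟨ *-assoc (A ^ β) (suc β ^ suc β) Z ⟨
  A ^ β * suc β ^ suc β * Z
    ≤⟨ am-gm-step β A Z ⟩
  (A + Z) ^ suc β * β ^ β
    ≡⟨ cong (λ z → z ^ suc β * β ^ β) (lem₂ (γ * Z) (α * Y) Z) ⟩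
  (suc γ * Z + α * Y) ^ suc β * β ^ β ∎)
  where
  open ≤-Reasoning
  β = γ + α
  A = γ * Z + α * Y
  instance
    β≢0 : NonZero β
    β≢0 = >-nonZero (≤-trans (>-nonZero⁻¹ α) (m≤n+m α γ))
  lem₁ : ∀ s y z w b → s * (y * (z * w)) * b ≡ b * (y * w) * (s * z)
  lem₁ = solve-∀
  lem₂ : ∀ x y Z → x + y + Z ≡ Z + x + y
  lem₂ = solve-∀

-- Exponents that the densities of a set and its complement can support.

-- With p = s / N, q = t / N and β = γ + α: if 2pβ ≤ α, then q ≥ 1 − α / 2β, and AM–GM
-- for α copies of 1 / 2 and γ copies of 1 gives q ^ β ≥ 2 ^ (- α).
small-density : ∀ γ α .{{_ : NonZero α}} s t → 2 * s * (γ + α) ≤ α * (s + t) →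
                (s + t) ^ (γ + α) ≤ 2 ^ α * t ^ (γ + α)
small-density γ α s t 2sβ≤αN =
  *-cancelʳ-≤ _ _ (β ^ β * 2 ^ γ) {{m*n≢0 _ _ {{m^n≢0 β β}} {{m^n≢0 2 γ}}}} (begin
  N ^ β * (β ^ β * 2 ^ γ)
    ≡⟨ cong (λ z → N ^ β * (β ^ β * z)) (trans (cong (_* 2 ^ γ) (^-zeroˡ α)) (*-identityˡ _)) ⟨
  N ^ β * (β ^ β * (1 ^ α * 2 ^ γ))
    ≤⟨ *-monoʳ-≤ (N ^ β) (weighted-am-gm γ α 1 2) ⟩
  N ^ β * (γ * 2 + α * 1) ^ β
    ≡⟨ ^-distribʳ-* β N _ ⟨
  (N * (γ * 2 + α * 1)) ^ β
    ≤⟨ ^-monoˡ-≤ β bound ⟩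
  (t * (2 * β)) ^ β
    ≡⟨ trans (^-distribʳ-* β t (2 * β)) (cong (t ^ β *_) (^-distribʳ-* β 2 β)) ⟩
  t ^ β * (2 ^ β * β ^ β)
    ≡⟨ cong (λ z → t ^ β * (z * β ^ β)) (^-distribˡ-+-* 2 γ α) ⟩
  t ^ β * (2 ^ γ * 2 ^ α * β ^ β)
    ≡⟨ lem₂ (t ^ β) (2 ^ γ) (2 ^ α) (β ^ β) ⟩
  2 ^ α * t ^ β * (β ^ β * 2 ^ γ) ∎)
  where
  open ≤-Reasoning
  β = γ + α
  N = s + t
  instance
    β≢0 : NonZero β
    β≢0 = >-nonZero (≤-trans (>-nonZero⁻¹ α) (m≤n+m α γ))
  lem₁ : ∀ γ α s t → (s + t) * (γ * 2 + α * 1) + α * (s + t) ≡ t * (2 * (γ + α)) + 2 * s * (γ + α)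
  lem₁ = solve-∀
  bound : N * (γ * 2 + α * 1) ≤ t * (2 * β)
  bound = +-cancelʳ-≤ (α * N) _ _ (begin
    N * (γ * 2 + α * 1) + α * N  ≡⟨ lem₁ γ α s t ⟩
    t * (2 * β) + 2 * s * β      ≤⟨ +-monoʳ-≤ (t * (2 * β)) 2sβ≤αN ⟩
    t * (2 * β) + α * N ∎)
  lem₂ : ∀ t g a b → t * (g * a * b) ≡ a * t * (b * g)
  lem₂ = solve-∀

-- Here t = s + d, so p ≤ 1 / 2.  If 2pβ ≥ α, then AM–GM for α copies of 1 + (1 − 2p) β / α
-- and γ copies of 1 gives (2p) ^ α (2q) ^ β ≥ 1.
large-density : ∀ γ α .{{_ : NonZero α}} s d → α * (s + (s + d)) ≤ 2 * s * (γ + α) →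
                (s + (s + d)) ^ (α + (γ + α)) ≤ (2 * s) ^ α * (2 * (s + d)) ^ (γ + α)
large-density γ α s d αN≤2sβ = *-cancelˡ-≤ (α ^ β) {{m^n≢0 α β}} (begin
  α ^ β * N ^ (α + β)
    ≡⟨ cong₂ _*_ (^-distribˡ-+-* α γ α) (trans (^-distribˡ-+-* N α β) (cong (N ^ α *_) (^-distribˡ-+-* N γ α))) ⟩
  α ^ γ * α ^ α * (N ^ α * (N ^ γ * N ^ α))
    ≡⟨ lem₁ (α ^ γ) (α ^ α) (N ^ α) (N ^ γ) ⟩
  α ^ α * N ^ α * N ^ α * (α ^ γ * N ^ γ)
    ≡⟨ cong₂ _*_ (trans (^-distribʳ-* α (α * N) N) (cong (_* N ^ α) (^-distribʳ-* α α N))) (^-distribʳ-* γ α N) ⟨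
  (α * N * N) ^ α * (α * N) ^ γ
    ≤⟨ *-monoˡ-≤ ((α * N) ^ γ) (^-monoˡ-≤ α bound) ⟩
  (2 * s * Y) ^ α * (α * N) ^ γ
    ≡⟨ trans (cong (_* (α * N) ^ γ) (^-distribʳ-* α (2 * s) Y)) (*-assoc ((2 * s) ^ α) (Y ^ α) _) ⟩
  (2 * s) ^ α * (Y ^ α * (α * N) ^ γ)
    ≤⟨ *-monoʳ-≤ ((2 * s) ^ α) mean ⟩
  (2 * s) ^ α * (α * (2 * t)) ^ β
    ≡⟨ cong ((2 * s) ^ α *_) (^-distribʳ-* β α (2 * t)) ⟩
  (2 * s) ^ α * (α ^ β * (2 * t) ^ β)
    ≡⟨ lem₂ ((2 * s) ^ α) (α ^ β) _ ⟩
  α ^ β * ((2 * s) ^ α * (2 * t) ^ β) ∎)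
  where
  open ≤-Reasoning
  β = γ + α
  t = s + d
  N = s + t
  Y = β * d + α * N
  instance
    β≢0 : NonZero β
    β≢0 = >-nonZero (≤-trans (>-nonZero⁻¹ α) (m≤n+m α γ))
  lem₁ : ∀ x y u v → x * y * (u * (v * u)) ≡ y * u * u * (x * v)
  lem₁ = solve-∀
  lem₂ : ∀ x y z → x * (y * z) ≡ y * (x * z)
  lem₂ = solve-∀
  lem₃ : ∀ α s d → α * (s + (s + d)) * (s + (s + d))
                 ≡ α * (s + (s + d)) * d + 2 * s * (α * (s + (s + d)))
  lem₃ = solve-∀
  lem₄ : ∀ s b d A → 2 * s * b * d + 2 * s * A ≡ 2 * s * (b * d + A)
  lem₄ = solve-∀
  bound : α * N * N ≤ 2 * s * Y
  bound = begin
    α * N * N                      ≡⟨ lem₃ α s d ⟩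
    α * N * d + 2 * s * (α * N)    ≤⟨ +-monoˡ-≤ _ (*-monoˡ-≤ d αN≤2sβ) ⟩
    2 * s * β * d + 2 * s * (α * N) ≡⟨ lem₄ s β d (α * N) ⟩
    2 * s * Y ∎
  lem₅ : ∀ γ α s d → γ * (α * (s + (s + d))) + α * ((γ + α) * d + α * (s + (s + d)))
                   ≡ (γ + α) * (α * (2 * (s + d)))
  lem₅ = solve-∀
  mean : Y ^ α * (α * N) ^ γ ≤ (α * (2 * t)) ^ β
  mean = *-cancelˡ-≤ (β ^ β) {{m^n≢0 β β}} (begin
    β ^ β * (Y ^ α * (α * N) ^ γ)     ≤⟨ weighted-am-gm γ α Y (α * N) ⟩
    (γ * (α * N) + α * Y) ^ β         ≡⟨ cong (_^ β) (lem₅ γ α s d) ⟩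
    (β * (α * (2 * t))) ^ β           ≡⟨ ^-distribʳ-* β β _ ⟩
    β ^ β * (α * (2 * t)) ^ β ∎)

-- As α is the smaller of the two exponents, 2α is at most their sum. This settles the cases where a
-- factor 2 ^ α suffices.
2^α≤M : ∀ γ α M → 2 ^ (α + (γ + α)) ≤ M * M → 2 ^ α ≤ M
2^α≤M γ α M 2^k≤M² = square-cancel-≤ (begin
  2 ^ α * 2 ^ α      ≡⟨ ^-distribˡ-+-* 2 α α ⟨
  2 ^ (α + α)        ≤⟨ ^-monoʳ-≤ 2 (+-monoʳ-≤ α (m≤n+m α γ)) ⟩
  2 ^ (α + (γ + α))  ≤⟨ 2^k≤M² ⟩
  M * M ∎)
  where open ≤-Reasoning

-- In densities: p ^ α < 1 / M and q ^ β < 1 / M are incompatible.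
incompatible-≤ : ∀ γ α .{{_ : NonZero α}} s t M → 2 ^ (α + (γ + α)) ≤ M * M →
                 M * s ^ α < (s + t) ^ α → M * t ^ (γ + α) < (s + t) ^ (γ + α) → ⊥
incompatible-≤ γ α s t M 2^k≤M² s-small t-small with ≤-total t s
... | inj₁ t≤s = <⇒≱ s-small (begin
  (s + t) ^ α    ≤⟨ ^-monoˡ-≤ α (+-monoʳ-≤ s (≤-trans t≤s (≤-reflexive (sym (+-identityʳ s))))) ⟩
  (2 * s) ^ α    ≡⟨ ^-distribʳ-* α 2 s ⟩
  2 ^ α * s ^ α  ≤⟨ *-monoˡ-≤ (s ^ α) (2^α≤M γ α M 2^k≤M²) ⟩
  M * s ^ α ∎)
  where open ≤-Reasoning
... | inj₂ s≤t with ≤-total (2 * s * (γ + α)) (α * (s + t))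
...   | inj₁ small = <⇒≱ t-small (begin
  (s + t) ^ (γ + α)     ≤⟨ small-density γ α s t small ⟩
  2 ^ α * t ^ (γ + α)   ≤⟨ *-monoˡ-≤ (t ^ (γ + α)) (2^α≤M γ α M 2^k≤M²) ⟩
  M * t ^ (γ + α) ∎)
  where open ≤-Reasoning
...   | inj₂ large with d , refl ← m≤n⇒∃[o]m+o≡n s≤t =
  <-irrefl refl (begin-strict
    N ^ (α + β)                          ≤⟨ large-density γ α s d large ⟩
    (2 * s) ^ α * (2 * t′) ^ β           ≡⟨ cong₂ _*_ (^-distribʳ-* α 2 s) (^-distribʳ-* β 2 t′) ⟩
    2 ^ α * s ^ α * (2 ^ β * t′ ^ β)     ≡⟨ lem₁ (2 ^ α) (s ^ α) (2 ^ β) (t′ ^ β) ⟩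
    2 ^ α * 2 ^ β * (s ^ α * t′ ^ β)     ≡⟨ cong (_* (s ^ α * t′ ^ β)) (^-distribˡ-+-* 2 α β) ⟨
    2 ^ (α + β) * (s ^ α * t′ ^ β)       ≤⟨ *-monoˡ-≤ (s ^ α * t′ ^ β) 2^k≤M² ⟩
    M * M * (s ^ α * t′ ^ β)             ≡⟨ lem₂ M (s ^ α) (t′ ^ β) ⟩
    M * s ^ α * (M * t′ ^ β)             <⟨ *-mono-< s-small t-small ⟩
    N ^ α * N ^ β                        ≡⟨ ^-distribˡ-+-* N α β ⟨
    N ^ (α + β) ∎)
  where
  open ≤-Reasoning
  β = γ + α
  t′ = s + d
  N = s + t′
  lem₁ : ∀ x y u v → x * y * (u * v) ≡ x * u * (y * v)
  lem₁ = solve-∀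
  lem₂ : ∀ m x y → m * m * (x * y) ≡ m * x * (m * y)
  lem₂ = solve-∀

-- If an exponent is zero, its hypothesis says M < 1, against the bound on M². Otherwise the
-- situation is symmetric in (α, s) and (β, t), so the smaller exponent may come first.
incompatible : ∀ α β s t M → 2 ^ (α + β) ≤ M * M →
               M * s ^ α < (s + t) ^ α → M * t ^ β < (s + t) ^ β → ⊥
incompatible zero β s t M 2^k≤M² s-small _
  rewrite n<1⇒n≡0 (subst (_< 1) (*-identityʳ M) s-small) = <⇒≱ (m^n>0 2 β) 2^k≤M²
incompatible (suc α) zero s t M 2^k≤M² _ t-small
  rewrite n<1⇒n≡0 (subst (_< 1) (*-identityʳ M) t-small) = <⇒≱ (m^n>0 2 (suc α + 0)) 2^k≤M²
incompatible α@(suc _) β@(suc _) s t M 2^k≤M² s-small t-small with ≤-total α β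
... | inj₁ α≤β = incompatible-≤ (β ∸ α) α s t M
      (subst (λ z → 2 ^ (α + z) ≤ M * M) eq 2^k≤M²) s-small
      (subst (λ z → M * t ^ z < (s + t) ^ z) eq t-small)
  where
  eq : β ≡ (β ∸ α) + α
  eq = sym (m∸n+n≡m α≤β)
... | inj₂ β≤α = incompatible-≤ (α ∸ β) β t s M
      (subst (λ z → 2 ^ z ≤ M * M) (trans (+-comm α β) (cong (β +_) eq)) 2^k≤M²)
      (subst (λ z → M * t ^ β < z ^ β) (+-comm s t) t-small)
      (subst₂ (λ z w → M * s ^ z < w ^ z) eq (+-comm s t) s-small)
  where
  eq : α ≡ (α ∸ β) + β
  eq = sym (m∸n+n≡m β≤α)

-- Exponent 0 is good because M ≥ 1. A scan upwards therefore either stays good as far as `j` or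
-- meets a first passage from good to bad.
last-good-exponent : ∀ M s N .{{_ : NonZero M}} j →
  N ^ j ≤ M * s ^ j ⊎
  ∃[ a ] suc a ≤ j × N ^ a ≤ M * s ^ a × M * s ^ suc a < N ^ suc a
last-good-exponent M s N zero = inj₁ (≤-trans (>-nonZero⁻¹ M) (≤-reflexive (sym (*-identityʳ M))))
last-good-exponent M s N (suc j) with last-good-exponent M s N j
... | inj₂ (a , a<j , good , bad) = inj₂ (a , m≤n⇒m≤1+n a<j , good , bad)
... | inj₁ good with N ^ suc j ≤? M * s ^ suc j
...   | yes good′ = inj₁ good′
...   | no bad = inj₂ (j , ≤-refl , good , ≰⇒> bad)

-- If `suc a` is the first bad exponent for `s`, then `incompatible` makes `κ ∸ suc a` good for `t`.
-- Stepping back from `suc a` to `a` is what costs the one in `κ ≤ suc (a + b)`.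
balanced-exponents : ∀ κ M s t → 2 ^ κ ≤ M * M → ∃[ a ] ∃[ b ]
  a ≤ κ × b ≤ κ × κ ≤ suc (a + b) × (s + t) ^ a ≤ M * s ^ a × (s + t) ^ b ≤ M * t ^ b
balanced-exponents κ zero s t 2^κ≤M² = ⊥-elim (<⇒≱ (m^n>0 2 κ) 2^κ≤M²)
balanced-exponents κ M@(suc _) s t 2^κ≤M² with last-good-exponent M s (s + t) κ
... | inj₁ good =
  κ , 0 , ≤-refl , z≤n , m≤n⇒m≤1+n (m≤m+n κ 0) , good , s≤s z≤n
... | inj₂ (a , a<κ , good , bad) =
  a , κ ∸ suc a , <⇒≤ a<κ , m∸n≤m κ (suc a) , ≤-reflexive (sym (m+[n∸m]≡n a<κ)) , good ,
  ≮⇒≥ (λ bad′ → incompatible (suc a) (κ ∸ suc a) s t M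
    (subst (λ z → 2 ^ z ≤ M * M) (sym (m+[n∸m]≡n a<κ)) 2^κ≤M²) bad bad′)

-- Since x / y ≤ 1, its powers decrease, so a lower bound 1 / C at a large exponent passes to
-- smaller ones. One large exponent then serves all a ≤ κ.
power-ratio-antitone : ∀ {x y C} .{{_ : NonZero y}} a e → x ≤ y →
                       y ^ (a + e) ≤ C * x ^ (a + e) → y ^ a ≤ C * x ^ a
power-ratio-antitone {x} {y} {C} a e x≤y h = *-cancelʳ-≤ _ _ (y ^ e) {{m^n≢0 y e}} (begin
  y ^ a * y ^ e        ≡⟨ ^-distribˡ-+-* y a e ⟨
  y ^ (a + e)          ≤⟨ h ⟩
  C * x ^ (a + e)      ≡⟨ cong (C *_) (^-distribˡ-+-* x a e) ⟩
  C * (x ^ a * x ^ e)  ≡⟨ *-assoc C (x ^ a) (x ^ e) ⟨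
  C * x ^ a * x ^ e    ≤⟨ *-monoʳ-≤ (C * x ^ a) (^-monoˡ-≤ e x≤y) ⟩
  C * x ^ a * y ^ e ∎)
  where open ≤-Reasoning

-- AM–GM for four copies of 1 / 2 and κ ∸ 2 copies of 1, whose mean is κ / (2 + κ).
[2+κ]^a≤16κ^a : ∀ κ a → a ≤ κ → (2 + κ) ^ a ≤ 16 * κ ^ a
[2+κ]^a≤16κ^a zero zero _ = s≤s z≤n
[2+κ]^a≤16κ^a (suc zero) zero _ = s≤s z≤n
[2+κ]^a≤16κ^a (suc zero) (suc zero) _ = s≤s (s≤s (s≤s z≤n))
[2+κ]^a≤16κ^a (suc zero) (suc (suc _)) (s≤s ())
[2+κ]^a≤16κ^a κ@(suc (suc j)) a a≤κ =
  power-ratio-antitone {κ} {2 + κ} {16} a (4 + j ∸ a) (m≤n+m κ 2)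
    (subst (λ z → (2 + κ) ^ z ≤ 16 * κ ^ z) (sym (m+[n∸m]≡n (≤-trans a≤κ (m≤n+m κ 2)))) main)
  where
  open ≤-Reasoning
  lem₁ : ∀ x y → x * (1 * y) ≡ y * x
  lem₁ = solve-∀
  lem₂ : ∀ j → j * 2 + 4 ≡ 2 * (2 + j)
  lem₂ = solve-∀
  lem₃ : ∀ x y → x * 16 * y ≡ x * (16 * y)
  lem₃ = solve-∀
  main : (4 + j) ^ (4 + j) ≤ 16 * κ ^ (4 + j)
  main = *-cancelˡ-≤ (2 ^ j) {{m^n≢0 2 j}} (begin
    2 ^ j * (4 + j) ^ (4 + j)               ≡⟨ lem₁ ((4 + j) ^ (4 + j)) (2 ^ j) ⟨
    (4 + j) ^ (4 + j) * (1 ^ 4 * 2 ^ j)     ≡⟨ cong (λ z → z ^ z * (1 ^ 4 * 2 ^ j)) (+-comm 4 j) ⟩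
    (j + 4) ^ (j + 4) * (1 ^ 4 * 2 ^ j)     ≤⟨ weighted-am-gm j 4 1 2 ⟩
    (j * 2 + 4) ^ (j + 4)                   ≡⟨ cong (_^ (j + 4)) (lem₂ j) ⟩
    (2 * κ) ^ (j + 4)                       ≡⟨ ^-distribʳ-* (j + 4) 2 κ ⟩
    2 ^ (j + 4) * κ ^ (j + 4)               ≡⟨ cong₂ _*_ (^-distribˡ-+-* 2 j 4) (cong (κ ^_) (+-comm j 4)) ⟩
    2 ^ j * 16 * κ ^ (4 + j)                ≡⟨ lem₃ (2 ^ j) (κ ^ (4 + j)) ⟩
    2 ^ j * (16 * κ ^ (4 + j)) ∎)

-- Removing κ points from either part leaves densities that still sum to at least one relative
-- to κ²; passing from κ² to κ (2 + κ) costs the factor 16.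
sequence-lengths : ∀ κ M s t → 2 ^ κ ≤ M * M → s + t ≡ κ * (2 + κ) → ∃[ a ] ∃[ b ]
  a ≤ κ × b ≤ κ × κ ≤ suc (a + b) ×
  (κ * (2 + κ)) ^ a ≤ 16 * M * (s ∸ κ) ^ a × (κ * (2 + κ)) ^ b ≤ 16 * M * (t ∸ κ) ^ b
sequence-lengths κ M s t 2^κ≤M² s+t≡N =
  let a , b , a≤κ , b≤κ , κ≤ , good-a , good-b = balanced-exponents κ M s′ t′ 2^κ≤M² in
  a , b , a≤κ , b≤κ , κ≤ , enlarge a a≤κ s′≤ good-a , enlarge b b≤κ t′≤ good-b
  where
  open ≤-Reasoning
  -- The cap makes `s′ + t′` exactly κ², and `κ²≤` ensures that `t′` still fits into `t ∸ κ`.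
  s′ = (s ∸ κ) ⊓ (κ * κ)
  t′ = κ * κ ∸ s′
  s′≤ : s′ ≤ s ∸ κ
  s′≤ = m⊓n≤m (s ∸ κ) (κ * κ)
  s′+t′≡κ² : s′ + t′ ≡ κ * κ
  s′+t′≡κ² = m+[n∸m]≡n (m⊓n≤n (s ∸ κ) (κ * κ))
  lem₁ : ∀ κ → κ * κ + (κ + κ) ≡ κ * (2 + κ)
  lem₁ = solve-∀
  lem₂ : ∀ x y κ → x + κ + (y + κ) ≡ x + y + (κ + κ)
  lem₂ = solve-∀
  κ²≤ : κ * κ ≤ (s ∸ κ) + (t ∸ κ)
  κ²≤ = +-cancelʳ-≤ (κ + κ) _ _ (begin
    κ * κ + (κ + κ)                ≡⟨ lem₁ κ ⟩
    κ * (2 + κ)                    ≡⟨ s+t≡N ⟨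
    s + t                          ≤⟨ +-mono-≤ (m≤n+m∸n s κ) (m≤n+m∸n t κ) ⟩
    κ + (s ∸ κ) + (κ + (t ∸ κ))    ≡⟨ cong₂ _+_ (+-comm κ _) (+-comm κ _) ⟩
    (s ∸ κ) + κ + ((t ∸ κ) + κ)    ≡⟨ lem₂ (s ∸ κ) (t ∸ κ) κ ⟩
    (s ∸ κ) + (t ∸ κ) + (κ + κ) ∎)
  t′≤ : t′ ≤ t ∸ κ
  t′≤ with ≤-total (s ∸ κ) (κ * κ)
  ... | inj₁ h rewrite m≤n⇒m⊓n≡m h = m≤n+o⇒m∸n≤o (κ * κ) (s ∸ κ) κ²≤
  ... | inj₂ h rewrite m≥n⇒m⊓n≡n h | n∸n≡0 (κ * κ) = z≤n
  lem₃ : ∀ x y → x * (16 * y) ≡ 16 * (x * y)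
  lem₃ = solve-∀
  enlarge : ∀ a → a ≤ κ → ∀ {u v} → u ≤ v → (s′ + t′) ^ a ≤ M * u ^ a →
            (κ * (2 + κ)) ^ a ≤ 16 * M * v ^ a
  enlarge a a≤κ {u} {v} u≤v good = begin
    (κ * (2 + κ)) ^ a          ≡⟨ ^-distribʳ-* a κ (2 + κ) ⟩
    κ ^ a * (2 + κ) ^ a        ≤⟨ *-monoʳ-≤ (κ ^ a) ([2+κ]^a≤16κ^a κ a a≤κ) ⟩
    κ ^ a * (16 * κ ^ a)       ≡⟨ lem₃ (κ ^ a) (κ ^ a) ⟩
    16 * (κ ^ a * κ ^ a)       ≡⟨ cong (16 *_) (^-distribʳ-* a κ κ) ⟨
    16 * (κ * κ) ^ a           ≡⟨ cong (λ z → 16 * z ^ a) s′+t′≡κ² ⟨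
    16 * (s′ + t′) ^ a         ≤⟨ *-monoʳ-≤ 16 good ⟩
    16 * (M * u ^ a)           ≤⟨ *-monoʳ-≤ 16 (*-monoʳ-≤ M (^-monoˡ-≤ a u≤v)) ⟩
    16 * (M * v ^ a)           ≡⟨ *-assoc 16 M (v ^ a) ⟨
    16 * M * v ^ a ∎

-- Finite sums over lists, averaging and indicators.

private
  variable
    A B C : Set

∑ : List A → (A → ℕ) → ℕ
∑ xs f = sum (map f xs)

∑-mono : ∀ (xs : List A) {f g : A → ℕ} → (∀ {x} → x ∈ xs → f x ≤ g x) → ∑ xs f ≤ ∑ xs g
∑-mono []       _ = z≤n
∑-mono (x ∷ xs) h = +-mono-≤ (h (here refl)) (∑-mono xs (h ∘ there))

∑-mono-< : ∀ {xs : List A} {f g : A → ℕ} {x} → (∀ y → f y ≤ g y) → x ∈ xs → f x < g x →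
           ∑ xs f < ∑ xs g
∑-mono-< {xs = _ ∷ xs} f≤g (here refl) fx<gx = +-mono-<-≤ fx<gx (∑-mono xs (λ {y} _ → f≤g y))
∑-mono-< {xs = y ∷ xs} f≤g (there x∈)  fx<gx = +-mono-≤-< (f≤g y) (∑-mono-< f≤g x∈ fx<gx)

∑-cong : ∀ (xs : List A) {f g : A → ℕ} → (∀ x → f x ≡ g x) → ∑ xs f ≡ ∑ xs g
∑-cong xs h = cong sum (map-cong h xs)

∑-const : ∀ (xs : List A) c → ∑ xs (λ _ → c) ≡ length xs * c
∑-const []       c = refl
∑-const (x ∷ xs) c = cong (c +_) (∑-const xs c)

length≡∑1 : ∀ (xs : List A) → length xs ≡ ∑ xs (λ _ → 1)
length≡∑1 xs = sym (trans (∑-const xs 1) (*-identityʳ _))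

∑-0 : ∀ (xs : List A) → ∑ xs (λ _ → 0) ≡ 0
∑-0 xs = trans (∑-const xs 0) (*-zeroʳ (length xs))

∑-distrib-+ : ∀ (xs : List A) (f g : A → ℕ) → ∑ xs (λ x → f x + g x) ≡ ∑ xs f + ∑ xs g
∑-distrib-+ []       f g = refl
∑-distrib-+ (x ∷ xs) f g rewrite ∑-distrib-+ xs f g = lem (f x) (g x) (∑ xs f) (∑ xs g)
  where
  lem : ∀ a b c d → a + b + (c + d) ≡ a + c + (b + d)
  lem = solve-∀

∑-distribˡ-* : ∀ (xs : List A) c (f : A → ℕ) → ∑ xs (λ x → c * f x) ≡ c * ∑ xs f
∑-distribˡ-* []       c f = sym (*-zeroʳ c)
∑-distribˡ-* (x ∷ xs) c f rewrite ∑-distribˡ-* xs c f = sym (*-distribˡ-+ c (f x) (∑ xs f))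

∑-swap : ∀ (xs : List A) (ys : List B) (f : A → B → ℕ) →
         ∑ xs (λ x → ∑ ys (f x)) ≡ ∑ ys (λ y → ∑ xs (λ x → f x y))
∑-swap []       ys f = sym (∑-0 ys)
∑-swap (x ∷ xs) ys f =
  trans (cong (∑ ys (f x) +_) (∑-swap xs ys f)) (sym (∑-distrib-+ ys (f x) _))

∑-++ : ∀ (xs ys : List A) (f : A → ℕ) → ∑ (xs ++ ys) f ≡ ∑ xs f + ∑ ys f
∑-++ xs ys f = trans (cong sum (map-++ f xs ys)) (sum-++ (map f xs) (map f ys))

∑-map : ∀ (xs : List A) (g : A → B) (f : B → ℕ) → ∑ (map g xs) f ≡ ∑ xs (f ∘ g)
∑-map xs g f = cong sum (sym (map-∘ xs))

∑-<⇒∃< : ∀ (xs : List A) (f g : A → ℕ) → ∑ xs f < ∑ xs g → ∃[ x ] x ∈ xs × f x < g x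
∑-<⇒∃< (x ∷ xs) f g h with f x <? g x
... | yes fx<gx = x , here refl , fx<gx
... | no fx≮gx with y , y∈xs , fy<gy ← ∑-<⇒∃< xs f g
        (+-cancelˡ-< (f x) _ _ (<-≤-trans h (+-monoˡ-≤ (∑ xs g) (≮⇒≥ fx≮gx)))) =
  y , there y∈xs , fy<gy

∑-∈-≤ : ∀ {xs : List A} {x} (f : A → ℕ) → x ∈ xs → f x ≤ ∑ xs f
∑-∈-≤ f (here refl) = m≤m+n _ _
∑-∈-≤ f (there h)   = ≤-trans (∑-∈-≤ f h) (m≤n+m _ _)

averaging : ∀ (xs : List A) (f : A → ℕ) m → 0 < length xs → length xs * m ≤ ∑ xs f →
            ∃[ x ] x ∈ xs × m ≤ f x
averaging xs f m nonempty h =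
  -- Adding one to each term makes the comparison of sums strict, as the list is nonempty.
  let x , x∈xs , m<1+fx = ∑-<⇒∃< xs (λ _ → m) (λ x → 1 + f x) larger in x , x∈xs , ≤-pred m<1+fx
  where
  open ≤-Reasoning
  larger : ∑ xs (λ _ → m) < ∑ xs (λ x → 1 + f x)
  larger = begin-strict
    ∑ xs (λ _ → m)               ≡⟨ ∑-const xs m ⟩
    length xs * m                ≤⟨ h ⟩
    ∑ xs f                       <⟨ m<n+m (∑ xs f) nonempty ⟩
    length xs + ∑ xs f           ≡⟨ cong (_+ ∑ xs f) (length≡∑1 xs) ⟩
    ∑ xs (λ _ → 1) + ∑ xs f      ≡⟨ ∑-distrib-+ xs (λ _ → 1) f ⟨
    ∑ xs (λ x → 1 + f x) ∎

∈⇒length>0 : ∀ {xs : List A} {x} → x ∈ xs → 0 < length xs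
∈⇒length>0 (here _)  = z<s
∈⇒length>0 (there _) = z<s

⟦_⟧ : {P : Set} → Dec P → ℕ
⟦ d ⟧ = if does d then 1 else 0

⟦×-dec⟧ : {P Q : Set} (p? : Dec P) (q? : Dec Q) → ⟦ p? ×-dec q? ⟧ ≡ ⟦ p? ⟧ * ⟦ q? ⟧
⟦×-dec⟧ (yes _) (yes _) = refl
⟦×-dec⟧ (yes _) (no _)  = refl
⟦×-dec⟧ (no _)  q?      = refl

⟦⟧≡1 : {P : Set} (p? : Dec P) → P → ⟦ p? ⟧ ≡ 1
⟦⟧≡1 (yes _) _ = refl
⟦⟧≡1 (no ¬p) p = ⊥-elim (¬p p)

⟦⟧-≤ : {P : Set} (p? : Dec P) (c x : ℕ) {y : ℕ} → (P → c * x ≤ y) → c * (⟦ p? ⟧ * x) ≤ y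
⟦⟧-≤ (yes p) c x h = ≤-trans (≤-reflexive (cong (c *_) (*-identityˡ x))) (h p)
⟦⟧-≤ (no _)  c x h = ≤-trans (≤-reflexive (*-zeroʳ c)) z≤n

length-filter-¬ : {P : A → Set} (P? : ∀ x → Dec (P x)) (xs : List A) →
                  length (filter (¬? ∘ P?) xs) + ∑ xs (λ x → ⟦ P? x ⟧) ≡ length xs
length-filter-¬ P? []       = refl
length-filter-¬ P? (x ∷ xs) with P? x
... | yes _ = trans (+-suc _ _) (cong suc (length-filter-¬ P? xs))
... | no  _ = cong suc (length-filter-¬ P? xs)

-- Greedy covering.

2r^[1+r]≤[1+r]^[1+r] : ∀ r → 2 * r ^ suc r ≤ suc r ^ suc r
2r^[1+r]≤[1+r]^[1+r] r = +-cancelʳ-≤ (r * r ^ suc r) _ _ (begin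
  2 * (r * r ^ r) + r * (r * r ^ r)            ≤⟨ m≤m+n _ (r ^ r) ⟩
  2 * (r * r ^ r) + r * (r * r ^ r) + r ^ r    ≡⟨ lem r (r ^ r) ⟩
  -- The tangent bound at `r` yields (1 + 1 / r) ^ (r + 1) ≥ 2, with `r ^ r` to spare.
  suc r * r ^ r * suc r                        ≤⟨ young r r (suc r) ⟩
  suc r ^ suc r + r * r ^ suc r ∎)
  where
  open ≤-Reasoning
  lem : ∀ r x → 2 * (r * x) + r * (r * x) + x ≡ suc r * x * suc r
  lem = solve-∀

-- Each block of r + 1 rounds at least halves what remains, so N + 1 blocks reduce 2 ^ N targets to
-- at most 1 / 2, hence to none.
shrunk-to-zero : ∀ r N i m → i ≡ suc r * suc N → suc r ^ i * m ≤ r ^ i * 2 ^ N → m ≡ 0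
shrunk-to-zero r N i zero    _  _      = refl
shrunk-to-zero r N i (suc m) i≡ shrink = ⊥-elim (<⇒≱ (m^n>0 (suc r) i) (begin
  suc r ^ i              ≤⟨ R^i≤x ⟩
  x                      ≤⟨ +-cancelˡ-≤ x x 0 (begin
    x + x                ≡⟨ lem (2 ^ N) (r ^ i) ⟨
    2 ^ suc N * r ^ i    ≤⟨ halving ⟩
    suc r ^ i            ≤⟨ R^i≤x ⟩
    x                    ≡⟨ +-identityʳ x ⟨
    x + 0 ∎) ⟩
  0 ∎))
  where
  open ≤-Reasoning
  x = r ^ i * 2 ^ N
  lem : ∀ x y → 2 * x * y ≡ y * x + y * x
  lem = solve-∀
  R^i≤x : suc r ^ i ≤ x
  R^i≤x = ≤-trans (m≤m*n (suc r ^ i) (suc m)) shrink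
  halving : 2 ^ suc N * r ^ i ≤ suc r ^ i
  halving = begin
    2 ^ suc N * r ^ i                 ≡⟨ cong (λ z → 2 ^ suc N * r ^ z) i≡ ⟩
    2 ^ suc N * r ^ (suc r * suc N)   ≡⟨ cong (2 ^ suc N *_) (^-*-assoc r (suc r) (suc N)) ⟨
    2 ^ suc N * (r ^ suc r) ^ suc N   ≡⟨ ^-distribʳ-* (suc N) 2 (r ^ suc r) ⟨
    (2 * r ^ suc r) ^ suc N           ≤⟨ ^-monoˡ-≤ (suc N) (2r^[1+r]≤[1+r]^[1+r] r) ⟩
    (suc r ^ suc r) ^ suc N           ≡⟨ ^-*-assoc (suc r) (suc r) (suc N) ⟩
    suc r ^ (suc r * suc N)           ≡⟨ cong (suc r ^_) i≡ ⟨
    suc r ^ i ∎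

module GreedyCover
  {Cand Target : Set} {Hit : Cand → Target → Set} (hit? : ∀ c t → Dec (Hit c t))
  (cands : List Cand) (nonempty : 0 < length cands) (r : ℕ)
  where

  -- Writing the threshold as 1 / (r + 1) lets a round leave the fraction r / (r + 1) without
  -- subtraction.
  Popular : Target → Set
  Popular t = length cands ≤ suc r * ∑ cands (λ c → ⟦ hit? c t ⟧)

  -- Double counting of the pairs (c, t) with c hitting t, followed by averaging over the
  -- candidates.
  best-candidate : ∀ ts → (∀ {t} → t ∈ ts → Popular t) →
                   ∃[ c ] c ∈ cands × length ts ≤ suc r * ∑ ts (λ t → ⟦ hit? c t ⟧)
  best-candidate ts popular = averaging cands _ (length ts) nonempty (begin
    length cands * length ts                            ≡⟨ *-comm (length cands) (length ts) ⟩
    length ts * length cands                            ≡⟨ ∑-const ts (length cands) ⟨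
    ∑ ts (λ _ → length cands)                           ≤⟨ ∑-mono ts popular ⟩
    ∑ ts (λ t → R * ∑ cands (λ c → ⟦ hit? c t ⟧))       ≡⟨ ∑-distribˡ-* ts R _ ⟩
    R * ∑ ts (λ t → ∑ cands (λ c → ⟦ hit? c t ⟧))       ≡⟨ cong (R *_) (∑-swap ts cands _) ⟩
    R * ∑ cands (λ c → ∑ ts (λ t → ⟦ hit? c t ⟧))       ≡⟨ ∑-distribˡ-* cands R _ ⟨
    ∑ cands (λ c → R * ∑ ts (λ t → ⟦ hit? c t ⟧)) ∎)
    where
    open ≤-Reasoning
    R = suc r

  -- Popularity is measured against the full candidate list, so the targets missed so far remain
  -- popular and the best candidate for them can be taken again.
  greedy : ∀ i ts → (∀ {t} → t ∈ ts → Popular t) →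
           ∃[ cs ] length cs ≤ i × (∀ {c} → c ∈ cs → c ∈ cands) × ∃[ rest ]
           (∀ {t} → t ∈ ts → t ∈ rest ⊎ ∃[ c ] c ∈ cs × Hit c t) ×
           suc r ^ i * length rest ≤ r ^ i * length ts
  greedy zero ts popular = [] , z≤n , (λ ()) , ts , inj₁ , ≤-refl
  greedy (suc i) ts popular
    with c , c∈ , half ← best-candidate ts popular
    with cs , len , cs⊆ , rest , covers , shrink ←
      greedy i (filter (¬? ∘ hit? c) ts) (popular ∘ proj₁ ∘ ∈-filter⁻ (¬? ∘ hit? c)) =
    c ∷ cs , s≤s len , (λ { (here refl) → c∈ ; (there h) → cs⊆ h }) , rest , covers′ , (begin
      R * R ^ i * length rest          ≡⟨ *-assoc R (R ^ i) (length rest) ⟩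
      R * (R ^ i * length rest)        ≤⟨ *-monoʳ-≤ R shrink ⟩
      R * (r ^ i * length ts′)         ≡⟨ lem₁ R (r ^ i) (length ts′) ⟩
      r ^ i * (R * length ts′)         ≤⟨ *-monoʳ-≤ (r ^ i) step ⟩
      r ^ i * (r * length ts)          ≡⟨ lem₂ (r ^ i) r (length ts) ⟩
      r * r ^ i * length ts ∎)
    where
    open ≤-Reasoning
    R = suc r
    ts′ = filter (¬? ∘ hit? c) ts
    h = ∑ ts (λ t → ⟦ hit? c t ⟧)
    lem₁ : ∀ x y z → x * (y * z) ≡ y * (x * z)
    lem₁ = solve-∀
    lem₂ : ∀ x y z → x * (y * z) ≡ y * x * z
    lem₂ = solve-∀
    step : R * length ts′ ≤ r * length ts
    step = +-cancelʳ-≤ (R * h) _ _ (begin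
      R * length ts′ + R * h    ≡⟨ *-distribˡ-+ R (length ts′) h ⟨
      R * (length ts′ + h)      ≡⟨ cong (R *_) (length-filter-¬ (hit? c) ts) ⟩
      length ts + r * length ts ≤⟨ +-monoˡ-≤ (r * length ts) half ⟩
      R * h + r * length ts     ≡⟨ +-comm (R * h) (r * length ts) ⟩
      r * length ts + R * h ∎)
    covers′ : ∀ {t} → t ∈ ts → t ∈ rest ⊎ ∃[ c′ ] c′ ∈ c ∷ cs × Hit c′ t
    covers′ {t} t∈ with hit? c t
    ... | yes hit = inj₂ (c , here refl , hit)
    ... | no miss with covers (∈-filter⁺ (¬? ∘ hit? c) t∈ miss)
    ...   | inj₁ t∈rest = inj₁ t∈rest
    ...   | inj₂ (c′ , c′∈ , hit) = inj₂ (c′ , there c′∈ , hit)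

  cover : ∀ N i ts → i ≡ suc r * suc N → length ts ≤ 2 ^ N → (∀ {t} → t ∈ ts → Popular t) →
          ∃[ cs ] length cs ≤ i × (∀ {c} → c ∈ cs → c ∈ cands) ×
          (∀ {t} → t ∈ ts → ∃[ c ] c ∈ cs × Hit c t)
  cover N i ts i≡ size popular
    with cs , len , cs⊆ , rest , covers , shrink ← greedy i ts popular =
    cs , len , cs⊆ , all-hit
    where
    all-hit : ∀ {t} → t ∈ ts → ∃[ c ] c ∈ cs × Hit c t
    all-hit t∈ with covers t∈
    ... | inj₂ hit = hit
    ... | inj₁ t∈rest = ⊥-elim (<⇒≢ (∈⇒length>0 t∈rest) (sym (shrunk-to-zero r N i (length rest) i≡
            (≤-trans shrink (*-monoʳ-≤ (r ^ i) size)))))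

-- Enumeration of subsets and counting of injective sequences.

subsets : ∀ n → List (Subset n)
subsets zero    = [] ∷ []
subsets (suc n) = map (outside ∷_) (subsets n) ++ map (inside ∷_) (subsets n)

∈-subsets : ∀ {n} (S : Subset n) → S ∈ subsets n
∈-subsets []            = here refl
∈-subsets (outside ∷ S) = ∈-++⁺ˡ (∈-map⁺ (outside ∷_) (∈-subsets S))
∈-subsets (inside ∷ S)  = ∈-++⁺ʳ _ (∈-map⁺ (inside ∷_) (∈-subsets S))

∑-subsets : ∀ n (f : Subset (suc n) → ℕ) →
            ∑ (subsets (suc n)) f ≡ ∑ (subsets n) (f ∘ (outside ∷_)) + ∑ (subsets n) (f ∘ (inside ∷_))
∑-subsets n f = trans (∑-++ (map (outside ∷_) (subsets n)) _ f)
  (cong₂ _+_ (∑-map (subsets n) (outside ∷_) f) (∑-map (subsets n) (inside ∷_) f))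

length-subsets : ∀ n → length (subsets n) ≡ 2 ^ n
length-subsets zero    = refl
length-subsets (suc n) = begin
  length (subsets (suc n))
    ≡⟨ length-++ (map (outside ∷_) (subsets n)) ⟩
  length (map (outside ∷_) (subsets n)) + length (map (inside ∷_) (subsets n))
    ≡⟨ cong₂ _+_ (length-map (outside ∷_) (subsets n)) (length-map (inside ∷_) (subsets n)) ⟩
  length (subsets n) + length (subsets n)
    ≡⟨ cong₂ _+_ (length-subsets n) (trans (length-subsets n) (sym (+-identityʳ (2 ^ n)))) ⟩
  2 ^ suc n ∎
  where open ≡-Reasoning

∑-∈≡∣∣ : ∀ {n} (S : Subset n) → ∑ (allFin n) (λ x → ⟦ x ∈? S ⟧) ≡ ∣ S ∣
∑-∈≡∣∣ S = trans (cong sum (map-tabulate (λ x → x) (λ x → ⟦ x ∈? S ⟧))) (go S)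
  where
  go : ∀ {n} (S : Subset n) → sum (tabulate (λ x → ⟦ x ∈? S ⟧)) ≡ ∣ S ∣
  go []            = refl
  go (outside ∷ S) = go S
  go (inside ∷ S)  = cong suc (go S)

-- An arbitrary `q` in place of `p - x` allows recursion on the vectors without unfolding the
-- difference.
∣p∣≤1+∣q∣ : ∀ {n} (p q : Subset n) x → (∀ {y} → y Sub.∈ p → y ≢ x → y Sub.∈ q) → ∣ p ∣ ≤ suc ∣ q ∣
∣p∣≤1+∣q∣ (s ∷ p) (t ∷ q) zero h = ≤-trans (∣s∷p∣≤1+∣p∣ s)
  (s≤s (≤-trans (p⊆q⇒∣p∣≤∣q∣ (λ y∈p → drop-there (h (there y∈p) (λ ())))) (∣p∣≤∣x∷p∣ t q)))
  where
  ∣s∷p∣≤1+∣p∣ : ∀ s → ∣ s ∷ p ∣ ≤ suc ∣ p ∣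
  ∣s∷p∣≤1+∣p∣ outside = n≤1+n _
  ∣s∷p∣≤1+∣p∣ inside  = ≤-refl
∣p∣≤1+∣q∣ (outside ∷ p) (t ∷ q) (suc x) h = ≤-trans
  (∣p∣≤1+∣q∣ p q x (λ y∈p y≢x → drop-there (h (there y∈p) (y≢x ∘ Fin.suc-injective))))
  (s≤s (∣p∣≤∣x∷p∣ t q))
∣p∣≤1+∣q∣ (inside ∷ p) (inside ∷ q) (suc x) h =
  s≤s (∣p∣≤1+∣q∣ p q x (λ y∈p y≢x → drop-there (h (there y∈p) (y≢x ∘ Fin.suc-injective))))
∣p∣≤1+∣q∣ (inside ∷ p) (outside ∷ q) (suc x) h with () ← h here (λ ())

∣p∣≤1+∣p-x∣ : ∀ {n} (p : Subset n) x → ∣ p ∣ ≤ suc ∣ p - x ∣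
∣p∣≤1+∣p-x∣ p x = ∣p∣≤1+∣q∣ p (p - x) x x∈p∧x≢y⇒x∈p-y

x∉p-x : ∀ {n} (p : Subset n) x → x Sub.∉ p - x
x∉p-x (_ ∷ p) (suc x) (there h) = x∉p-x p x h

sequences : ∀ N → ℕ → List (List (Fin N))
sequences N zero    = [] ∷ []
sequences N (suc a) = cartesianProductWith _∷_ (allFin N) (sequences N a)

∑-cartesianProductWith : ∀ (g : A → B → C) xs ys (f : C → ℕ) →
  ∑ (cartesianProductWith g xs ys) f ≡ ∑ xs (λ x → ∑ ys (λ y → f (g x y)))
∑-cartesianProductWith g []       ys f = refl
∑-cartesianProductWith g (x ∷ xs) ys f = trans (∑-++ (map (g x) ys) _ f)
  (cong₂ _+_ (∑-map ys (g x) f) (∑-cartesianProductWith g xs ys f))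

length-sequences : ∀ N a → length (sequences N a) ≡ N ^ a
length-sequences N zero    = refl
length-sequences N (suc a) = begin
  length (sequences N (suc a))                        ≡⟨ length≡∑1 (sequences N (suc a)) ⟩
  ∑ (sequences N (suc a)) (λ _ → 1)                   ≡⟨ ∑-cartesianProductWith _∷_ (allFin N) (sequences N a) _ ⟩
  ∑ (allFin N) (λ _ → ∑ (sequences N a) (λ _ → 1))    ≡⟨ ∑-const (allFin N) _ ⟩
  length (allFin N) * ∑ (sequences N a) (λ _ → 1)     ≡⟨ cong₂ _*_ (length-tabulate {n = N} (λ x → x)) (sym (length≡∑1 (sequences N a))) ⟩
  N * length (sequences N a)                          ≡⟨ cong (N *_) (length-sequences N a) ⟩
  N * N ^ a ∎
  where open ≡-Reasoning

∈-sequences⇒length : ∀ N a {v} → v ∈ sequences N a → length v ≡ a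
∈-sequences⇒length N zero    (here refl) = refl
∈-sequences⇒length N (suc a) v∈
  with _ , _ , _ , w∈ , refl ← ∈-cartesianProductWith⁻ _∷_ (allFin N) (sequences N a) v∈ =
  cong suc (∈-sequences⇒length N a w∈)

-- Removing each entry from S also forces the entries to be distinct.
Inside : ∀ {N} → List (Fin N) → Subset N → Set
Inside []      S = ⊤
Inside (x ∷ v) S = x Sub.∈ S × Inside v (S - x)

inside? : ∀ {N} (v : List (Fin N)) S → Dec (Inside v S)
inside? []      S = yes tt
inside? (x ∷ v) S = (x ∈? S) ×-dec inside? v (S - x)

-- Each choice removes one point, so with d + a points at the start at least d are available at each
-- of the a choices.
count-inside : ∀ N a d (S : Subset N) → d + a ≤ ∣ S ∣ →
               d ^ a ≤ ∑ (sequences N a) (λ v → ⟦ inside? v S ⟧)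
count-inside N zero    d S _ = s≤s z≤n
count-inside N (suc a) d S h = begin
  d * d ^ a
    ≤⟨ *-monoˡ-≤ (d ^ a) (≤-trans (m≤m+n d (suc a)) h) ⟩
  ∣ S ∣ * d ^ a
    ≡⟨ trans (*-comm ∣ S ∣ (d ^ a)) (cong (d ^ a *_) (sym (∑-∈≡∣∣ S))) ⟩
  d ^ a * ∑ (allFin N) (λ x → ⟦ x ∈? S ⟧)
    ≡⟨ ∑-distribˡ-* (allFin N) (d ^ a) (λ x → ⟦ x ∈? S ⟧) ⟨
  ∑ (allFin N) (λ x → d ^ a * ⟦ x ∈? S ⟧)
    ≤⟨ ∑-mono (allFin N) (λ {x} _ → extend x) ⟩
  ∑ (allFin N) (λ x → ∑ (sequences N a) (λ v → ⟦ inside? (x ∷ v) S ⟧))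
    ≡⟨ ∑-cartesianProductWith _∷_ (allFin N) (sequences N a) (λ v → ⟦ inside? v S ⟧) ⟨
  ∑ (sequences N (suc a)) (λ v → ⟦ inside? v S ⟧) ∎
  where
  open ≤-Reasoning
  smaller : ∀ x → d + a ≤ ∣ S - x ∣
  smaller x = ≤-pred (begin
    suc (d + a)     ≡⟨ +-suc d a ⟨
    d + suc a       ≤⟨ h ⟩
    ∣ S ∣           ≤⟨ ∣p∣≤1+∣p-x∣ S x ⟩
    suc ∣ S - x ∣ ∎)
  extend : ∀ x → d ^ a * ⟦ x ∈? S ⟧ ≤ ∑ (sequences N a) (λ v → ⟦ inside? (x ∷ v) S ⟧)
  extend x = begin
    d ^ a * ⟦ x ∈? S ⟧
      ≡⟨ *-comm (d ^ a) ⟦ x ∈? S ⟧ ⟩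
    ⟦ x ∈? S ⟧ * d ^ a
      ≤⟨ *-monoʳ-≤ ⟦ x ∈? S ⟧ (count-inside N a d (S - x) (smaller x)) ⟩
    ⟦ x ∈? S ⟧ * ∑ (sequences N a) (λ v → ⟦ inside? v (S - x) ⟧)
      ≡⟨ ∑-distribˡ-* (sequences N a) ⟦ x ∈? S ⟧ (λ v → ⟦ inside? v (S - x) ⟧) ⟨
    ∑ (sequences N a) (λ v → ⟦ x ∈? S ⟧ * ⟦ inside? v (S - x) ⟧)
      ≡⟨ ∑-cong (sequences N a) (λ v → ⟦×-dec⟧ (x ∈? S) (inside? v (S - x))) ⟨
    ∑ (sequences N a) (λ v → ⟦ inside? (x ∷ v) S ⟧) ∎

count-inside-∸ : ∀ N κ a (S : Subset N) → a ≤ κ →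
                 (∣ S ∣ ∸ κ) ^ a ≤ ∑ (sequences N a) (λ v → ⟦ inside? v S ⟧)
count-inside-∸ N κ a S a≤κ with ≤-total κ ∣ S ∣
... | inj₁ κ≤∣S∣ = count-inside N a _ S
      (≤-trans (+-monoʳ-≤ (∣ S ∣ ∸ κ) a≤κ) (≤-reflexive (m∸n+n≡m κ≤∣S∣)))
... | inj₂ ∣S∣≤κ = subst (λ d → d ^ a ≤ ∑ (sequences N a) (λ v → ⟦ inside? v S ⟧)) (sym (m≤n⇒m∸n≡0 ∣S∣≤κ)) (0^a≤ a)
  where
  0^a≤ : ∀ a → 0 ^ a ≤ ∑ (sequences N a) (λ v → ⟦ inside? v S ⟧)
  -- Here 0 ^ 0 = 1 counts the empty sequence, which is inside every set.
  0^a≤ zero    = s≤s z≤n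
  0^a≤ (suc _) = z≤n

-- Chains through a set and growth of the chain count.

module _ {n : ℕ} where

  -- Positivity of `chainsEnding` with its witnesses made explicit; `Up` is the mirror image. The
  -- endpoint may lie outside the family, so that it can be the set being added.
  Down : List (Subset n) → ℕ → Subset n → Set
  Down 𝓕 zero    A = ⊤
  Down 𝓕 (suc j) A = ∃[ B ] B ∈ 𝓕 × B ⊂ A × Down 𝓕 j B

  Up : List (Subset n) → ℕ → Subset n → Set
  Up 𝓕 zero    A = ⊤
  Up 𝓕 (suc j) A = ∃[ B ] B ∈ 𝓕 × A ⊂ B × Up 𝓕 j B

  Down-⊆ : ∀ {𝓕 𝓖} → (∀ {A} → A ∈ 𝓕 → A ∈ 𝓖) → ∀ j {A} → Down 𝓕 j A → Down 𝓖 j A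
  Down-⊆ h zero    _                    = tt
  Down-⊆ h (suc j) (B , B∈ , B⊂A , down) = B , h B∈ , B⊂A , Down-⊆ h j down

  Up-⊆ : ∀ {𝓕 𝓖} → (∀ {A} → A ∈ 𝓕 → A ∈ 𝓖) → ∀ j {A} → Up 𝓕 j A → Up 𝓖 j A
  Up-⊆ h zero    _                  = tt
  Up-⊆ h (suc j) (B , B∈ , A⊂B , up) = B , h B∈ , A⊂B , Up-⊆ h j up

  Up-shorten : ∀ {𝓕 i j A} → i ≤ j → Up 𝓕 j A → Up 𝓕 i A
  Up-shorten z≤n       _                  = tt
  Up-shorten (s≤s i≤j) (B , B∈ , A⊂B , up) = B , B∈ , A⊂B , Up-shorten i≤j up

  Down⇒≤∣∣ : ∀ {𝓕} j {A} → Down 𝓕 j A → j ≤ ∣ A ∣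
  Down⇒≤∣∣ zero    _                    = z≤n
  Down⇒≤∣∣ (suc j) (B , _ , B⊂A , down) = ≤-trans (s≤s (Down⇒≤∣∣ j down)) (p⊂q⇒∣p∣<∣q∣ B⊂A)

  Up⇒∣∣+≤ : ∀ {𝓕} j {A} → Up 𝓕 j A → ∣ A ∣ + j ≤ n
  Up⇒∣∣+≤ zero    {A} _                  = ≤-trans (≤-reflexive (+-identityʳ ∣ A ∣)) (∣p∣≤n A)
  Up⇒∣∣+≤ (suc j) {A} (B , _ , A⊂B , up) = ≤-trans (≤-reflexive (+-suc ∣ A ∣ j))
    (≤-trans (+-monoˡ-≤ j (p⊂q⇒∣p∣<∣q∣ A⊂B)) (Up⇒∣∣+≤ j up))

  Down⇒0<chainsEnding : ∀ {𝓕} j {A} → Down 𝓕 j A → 0 < chainsEnding 𝓕 j A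
  Down⇒0<chainsEnding zero        _                    = z<s
  Down⇒0<chainsEnding (suc j) {A} (B , B∈ , B⊂A , down) =
    ≤-trans (Down⇒0<chainsEnding j down) (∑-∈-≤ _ (∈-filter⁺ (_⊂? A) B∈ B⊂A))

  0<chainsEnding⇒Down : ∀ {𝓕} j {A} → 0 < chainsEnding 𝓕 j A → Down 𝓕 j A
  0<chainsEnding⇒Down zero _ = tt
  0<chainsEnding⇒Down {𝓕} (suc j) {A} pos =
    let B , B∈ , pos′ = ∑-<⇒∃< below (λ _ → 0) (chainsEnding 𝓕 j)
          (subst (_< ∑ below (chainsEnding 𝓕 j)) (sym (∑-0 below)) pos)
        B∈𝓕 , B⊂A = ∈-filter⁻ (_⊂? A) B∈
    in B , B∈𝓕 , B⊂A , 0<chainsEnding⇒Down j pos′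
    where below = filter (_⊂? A) 𝓕

  module _ (𝓕 : List (Subset n)) (S : Subset n) where

    private
      below : Subset n → List (Subset n)
      below A = filter (_⊂? A) 𝓕

    chainsEnding-∷-⊂ : ∀ j {A} → S ⊂ A → chainsEnding (S ∷ 𝓕) (suc j) A ≡
                       chainsEnding (S ∷ 𝓕) j S + ∑ (below A) (chainsEnding (S ∷ 𝓕) j)
    chainsEnding-∷-⊂ j {A} S⊂A = cong (λ xs → ∑ xs (chainsEnding (S ∷ 𝓕) j)) (filter-accept (_⊂? A) S⊂A)

    ∑-below-≤ : ∀ j A → ∑ (below A) (chainsEnding (S ∷ 𝓕) j) ≤ chainsEnding (S ∷ 𝓕) (suc j) A
    ∑-below-≤ j A with S ⊂? A
    ... | yes S⊂A = m≤n+m _ _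
    ... | no _    = ≤-refl

    chainsEnding-mono : ∀ j A → chainsEnding 𝓕 j A ≤ chainsEnding (S ∷ 𝓕) j A
    chainsEnding-mono zero    A = ≤-refl
    chainsEnding-mono (suc j) A =
      ≤-trans (∑-mono (below A) (λ {B} _ → chainsEnding-mono j B)) (∑-below-≤ j A)

    -- Strict growth of the count stands for a new chain through `S` ending at `A`; no chains have
    -- to be listed.
    Gap : ℕ → Subset n → Set
    Gap j A = chainsEnding 𝓕 j A < chainsEnding (S ∷ 𝓕) j A

    -- The set `S` contributes a new positive term to the sum over the sets below `A`, and no old
    -- term decreases.
    Gap-above : ∀ i {A} → Down (S ∷ 𝓕) i S → S ⊂ A → Gap (suc i) A
    Gap-above i {A} down S⊂A = ≤-trans
      (+-mono-≤ (Down⇒0<chainsEnding i down) (∑-mono (below A) (λ {B} _ → chainsEnding-mono i B)))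
      (≤-reflexive (sym (chainsEnding-∷-⊂ i S⊂A)))

    Gap-step : ∀ j {A B} → B ∈ 𝓕 → B ⊂ A → Gap j B → Gap (suc j) A
    Gap-step j {A} B∈ B⊂A gap =
      <-≤-trans (∑-mono-< (chainsEnding-mono j) (∈-filter⁺ (_⊂? A) B∈ B⊂A) gap) (∑-below-≤ j A)

    Gap-top : ∀ l j {A} → A ∈ 𝓕 → Up 𝓕 l A → Gap j A → ∃[ B ] B ∈ 𝓕 × Gap (l + j) B
    Gap-top zero    j {A} A∈ _                  gap = A , A∈ , gap
    Gap-top (suc l) j     A∈ (B , B∈ , A⊂B , up) gap
      with C , C∈ , gap′ ← Gap-top l (suc j) B∈ up (Gap-step j A∈ A⊂B gap) =
      C , C∈ , subst (λ z → Gap z C) (+-suc l j) gap′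

    -- For j = 0 the new summand at `S` is itself positive. Otherwise the gap at the first set above
    -- `S` is carried along the upward chain to a member of `𝓕`, whose summand grows.
    Down-Up⇒chainCount-< : ∀ i j → Down 𝓕 i S → Up 𝓕 j S →
                           chainCount (j + i) 𝓕 < chainCount (j + i) (S ∷ 𝓕)
    Down-Up⇒chainCount-< i zero down _ =
      +-mono-≤ (Down⇒0<chainsEnding i (Down-⊆ there i down)) (∑-mono 𝓕 (λ {B} _ → chainsEnding-mono i B))
    Down-Up⇒chainCount-< i (suc l) down (B , B∈ , S⊂B , up)
      with C , C∈ , gap ← Gap-top l (suc i) B∈ up (Gap-above i (Down-⊆ there i down) S⊂B) =
      <-≤-trans (∑-mono-< (chainsEnding-mono (suc l + i)) C∈ (subst (λ z → Gap z C) (+-suc l i) gap))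
                (m≤n+m _ _)

    -- The count at `A` is a sum over the sets below it, so its growth comes from the new term at
    -- `S` or from an old term that grew.
    Gap⇒below : ∀ j {A} → Gap (suc j) A →
                S ⊂ A × Down (S ∷ 𝓕) j S ⊎ ∃[ B ] B ∈ 𝓕 × B ⊂ A × Gap j B
    Gap⇒below j {A} gap with S ⊂? A | 0 <? chainsEnding (S ∷ 𝓕) j S
    ... | yes S⊂A | yes pos = inj₁ (S⊂A , 0<chainsEnding⇒Down j pos)
    ... | yes S⊂A | no ¬pos
      with B , B∈ , gap′ ← ∑-<⇒∃< (below A) (chainsEnding 𝓕 j) (chainsEnding (S ∷ 𝓕) j)
             (<-≤-trans gap (+-monoˡ-≤ (∑ (below A) (chainsEnding (S ∷ 𝓕) j)) (≮⇒≥ ¬pos)))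
      with B∈𝓕 , B⊂A ← ∈-filter⁻ (_⊂? A) B∈ = inj₂ (B , B∈𝓕 , B⊂A , gap′)
    Gap⇒below j {A} gap | no S⊄A | _
      with B , B∈ , gap′ ← ∑-<⇒∃< (below A) (chainsEnding 𝓕 j) (chainsEnding (S ∷ 𝓕) j) gap
      with B∈𝓕 , B⊂A ← ∈-filter⁻ (_⊂? A) B∈ = inj₂ (B , B∈𝓕 , B⊂A , gap′)

    -- Follow the growth downwards and store the sets passed as an upward chain. The descent must
    -- reach `S`, since at j = 0 the count is constantly 1 and leaves no gap.
    Gap⇒Down-Up : ∀ j l {A} → A ∈ 𝓕 → Up 𝓕 l A → Gap j A →
                  ∃[ i ] ∃[ i′ ] i + i′ ≡ j + l × Down (S ∷ 𝓕) i S × Up 𝓕 i′ S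
    Gap⇒Down-Up zero    l A∈ up gap = ⊥-elim (<-irrefl refl gap)
    Gap⇒Down-Up (suc j) l {A} A∈ up gap with Gap⇒below j gap
    ... | inj₁ (S⊂A , down) = j , suc l , +-suc j l , down , A , A∈ , S⊂A , up
    ... | inj₂ (B , B∈ , B⊂A , gap′)
      with i , i′ , eq , down , up′ ← Gap⇒Down-Up j (suc l) B∈ (A , A∈ , B⊂A , up) gap′ =
      i , i′ , trans eq (+-suc j l) , down , up′

    chainCount-<⇒Down-Up : ∀ k → chainCount k 𝓕 < chainCount k (S ∷ 𝓕) →
                           ∃[ i ] ∃[ j ] i + j ≡ k × Down (S ∷ 𝓕) i S × Up 𝓕 j S
    chainCount-<⇒Down-Up k lt with 0 <? chainsEnding (S ∷ 𝓕) k S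
    ... | yes pos = k , 0 , +-identityʳ k , 0<chainsEnding⇒Down k pos , tt
    ... | no ¬pos
      with A , A∈ , gap ← ∑-<⇒∃< 𝓕 (chainsEnding 𝓕 k) (chainsEnding (S ∷ 𝓕) k)
             (<-≤-trans lt (+-monoˡ-≤ (∑ 𝓕 (chainsEnding (S ∷ 𝓕) k)) (≮⇒≥ ¬pos)))
      with i , j , eq , down , up ← Gap⇒Down-Up k 0 A∈ tt gap =
      i , j , trans eq (+-identityʳ k) , down , up

-- Lower bound by double counting.

_≟ˢ_ : ∀ {n} → DecidableEquality (Subset n)
_≟ˢ_ = ≡-dec _≟_

-- The indicator of `A ⊆ S`, defined coordinatewise so that sums over `subsets` split at the first
-- coordinate.
sub : ∀ {n} → Subset n → Subset n → ℕ
sub []            []            = 1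
sub (outside ∷ A) (_ ∷ S)       = sub A S
sub (inside ∷ A)  (inside ∷ S)  = sub A S
sub (inside ∷ A)  (outside ∷ S) = 0

⊆⇒sub≡1 : ∀ {n} (A S : Subset n) → A ⊆ S → sub A S ≡ 1
⊆⇒sub≡1 []            []            _ = refl
⊆⇒sub≡1 (outside ∷ A) (_ ∷ S)       h = ⊆⇒sub≡1 A S (drop-∷-⊆ h)
⊆⇒sub≡1 (inside ∷ A)  (inside ∷ S)  h = ⊆⇒sub≡1 A S (drop-∷-⊆ h)
⊆⇒sub≡1 (inside ∷ A)  (outside ∷ S) h with () ← h here

-- A coordinate in `A` is forced and any other is free. The factor 2 ^ ∣A∣ avoids the exponent n -
-- ∣A∣.
∑-supersets : ∀ {n} (A : Subset n) → 2 ^ ∣ A ∣ * ∑ (subsets n) (sub A) ≡ 2 ^ n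
∑-supersets []            = refl
∑-supersets {suc n} (outside ∷ A) = begin
  2 ^ ∣ A ∣ * ∑ (subsets (suc n)) (sub (outside ∷ A))  ≡⟨ cong (2 ^ ∣ A ∣ *_) (∑-subsets n (sub (outside ∷ A))) ⟩
  2 ^ ∣ A ∣ * (∑ (subsets n) (sub A) + ∑ (subsets n) (sub A)) ≡⟨ lem (2 ^ ∣ A ∣) (∑ (subsets n) (sub A)) ⟩
  2 * (2 ^ ∣ A ∣ * ∑ (subsets n) (sub A))              ≡⟨ cong (2 *_) (∑-supersets A) ⟩
  2 * 2 ^ n ∎
  where
  open ≡-Reasoning
  lem : ∀ x y → x * (y + y) ≡ 2 * (x * y)
  lem = solve-∀
∑-supersets {suc n} (inside ∷ A) = begin
  2 * 2 ^ ∣ A ∣ * ∑ (subsets (suc n)) (sub (inside ∷ A))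
    ≡⟨ cong (2 * 2 ^ ∣ A ∣ *_) (trans (∑-subsets n (sub (inside ∷ A))) (cong (_+ ∑ (subsets n) (sub A)) (∑-0 (subsets n)))) ⟩
  2 * 2 ^ ∣ A ∣ * ∑ (subsets n) (sub A)     ≡⟨ *-assoc 2 (2 ^ ∣ A ∣) _ ⟩
  2 * (2 ^ ∣ A ∣ * ∑ (subsets n) (sub A))   ≡⟨ cong (2 *_) (∑-supersets A) ⟩
  2 * 2 ^ n ∎
  where open ≡-Reasoning

∑-subsets-of : ∀ {n} (A : Subset n) → ∑ (subsets n) (λ S → sub S A) ≡ 2 ^ ∣ A ∣
∑-subsets-of []            = refl
∑-subsets-of {suc n} (outside ∷ A) = trans (∑-subsets n (λ S → sub S (outside ∷ A)))
  (trans (cong₂ _+_ (∑-subsets-of A) (∑-0 (subsets n))) (+-identityʳ _))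
∑-subsets-of {suc n} (inside ∷ A) = trans (∑-subsets n (λ S → sub S (inside ∷ A)))
  (cong₂ _+_ (∑-subsets-of A) (trans (∑-subsets-of A) (sym (+-identityʳ _))))

module LowerBound {n k m : ℕ} (𝓕 : List (Subset n)) (osat : Oversaturated k 𝓕)
                  (2m<k : m + m < k) (2m≤n : m + m ≤ n) where

  Witness : Subset n → Subset n → Set
  Witness S A = (m ≤ ∣ A ∣ × A ⊆ S) ⊎ (∣ A ∣ + m ≤ n × S ⊆ A)

  -- Oversaturation says nothing about members of `𝓕`; they witness themselves, because 2m ≤ n
  -- leaves at least m points inside or m points outside.
  self-witness : ∀ S → Witness S S
  self-witness S with ≤-total m ∣ S ∣
  ... | inj₁ m≤∣S∣ = inj₁ (m≤∣S∣ , ⊆-refl)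
  ... | inj₂ ∣S∣≤m = inj₂ (≤-trans (+-monoˡ-≤ m ∣S∣≤m) 2m≤n , ⊆-refl)

  -- As i + j = k > 2m, one side has more than m sets. Its set next to `S` has at least m further
  -- sets beyond it, which forces its size or its number of missing points to be at least m.
  long-chain : ∀ {S} i j → i + j ≡ k → Down (S ∷ 𝓕) i S → Up 𝓕 j S → ∃[ A ] A ∈ 𝓕 × Witness S A
  long-chain {S} (suc i) j eq (A , A∈ , A⊂S , down) up with m ≤? i
  ... | yes m≤i = A , A∈𝓕 A∈ , inj₁ (≤-trans m≤i (Down⇒≤∣∣ i down) , proj₁ A⊂S)
    where
    -- The downward chain lives in `S ∷ 𝓕`, but strict inclusion in `S` rules out `S` itself.
    A∈𝓕 : A ∈ S ∷ 𝓕 → A ∈ 𝓕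
    A∈𝓕 (here refl) = ⊥-elim (⊂-irref refl A⊂S)
    A∈𝓕 (there h)   = h
  long-chain {S} (suc i) (suc j) eq _ (A , A∈ , S⊂A , up) | no i≱m =
    A , A∈ , inj₂ (≤-trans (+-monoʳ-≤ ∣ A ∣ m≤j) (Up⇒∣∣+≤ j up) , proj₁ S⊂A)
    where
    m≤j : m ≤ j
    m≤j = +-cancelˡ-≤ m m j (≤-pred (begin
      suc (m + m)     ≤⟨ 2m<k ⟩
      k               ≡⟨ eq ⟨
      suc i + suc j   ≤⟨ +-monoˡ-≤ (suc j) (≰⇒> i≱m) ⟩
      m + suc j       ≡⟨ +-suc m j ⟩
      suc (m + j) ∎))
      where open ≤-Reasoning
  long-chain {S} (suc i) zero eq _ _ | no i≱m = ⊥-elim (<⇒≱ 2m<k (begin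
    k           ≡⟨ eq ⟨
    suc i + 0   ≡⟨ +-identityʳ (suc i) ⟩
    suc i       ≤⟨ ≰⇒> i≱m ⟩
    m           ≤⟨ m≤m+n m m ⟩
    m + m ∎))
    where open ≤-Reasoning
  long-chain {S} zero zero eq _ _ = ⊥-elim (n≮0 (subst (m + m <_) (sym eq) 2m<k))
  long-chain {S} zero (suc j) eq _ (A , A∈ , S⊂A , up) =
    A , A∈ , inj₂ (≤-trans (+-monoʳ-≤ ∣ A ∣ (≤-trans (m≤m+n m m) (≤-pred (subst (m + m <_) (sym eq) 2m<k)))) (Up⇒∣∣+≤ j up) , proj₁ S⊂A)

  witness : ∀ S → ∃[ A ] A ∈ 𝓕 × Witness S A
  witness S with DecMembership._∈?_ _≟ˢ_ S 𝓕
  ... | yes S∈ = S , S∈ , self-witness S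
  ... | no S∉ with i , j , eq , down , up ← chainCount-<⇒Down-Up 𝓕 S k (osat S S∉) =
    long-chain i j eq down up

  -- At least 1 on witnesses. The two kinds are added so that each can be summed over all `S` on its
  -- own.
  weight : Subset n → Subset n → ℕ
  weight A S = ⟦ m ≤? ∣ A ∣ ⟧ * sub A S + ⟦ ∣ A ∣ + m ≤? n ⟧ * sub S A

  witness-weight : ∀ {S A} → Witness S A → 1 ≤ weight A S
  witness-weight {S} {A} (inj₁ (m≤ , A⊆S)) = ≤-trans
    (≤-reflexive (sym (cong₂ _*_ (⟦⟧≡1 (m ≤? ∣ A ∣) m≤) (⊆⇒sub≡1 A S A⊆S)))) (m≤m+n _ _)
  witness-weight {S} {A} (inj₂ (≤n , S⊆A)) = ≤-trans
    (≤-reflexive (sym (cong₂ _*_ (⟦⟧≡1 (∣ A ∣ + m ≤? n) ≤n) (⊆⇒sub≡1 S A S⊆A)))) (m≤n+m _ _)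

  weight-supersets : ∀ A → 2 ^ m * (⟦ m ≤? ∣ A ∣ ⟧ * ∑ (subsets n) (sub A)) ≤ 2 ^ n
  weight-supersets A = ⟦⟧-≤ (m ≤? ∣ A ∣) (2 ^ m) (∑ (subsets n) (sub A)) λ m≤ → begin
    2 ^ m * ∑ (subsets n) (sub A)        ≤⟨ *-monoˡ-≤ _ (^-monoʳ-≤ 2 m≤) ⟩
    2 ^ ∣ A ∣ * ∑ (subsets n) (sub A)    ≡⟨ ∑-supersets A ⟩
    2 ^ n ∎
    where open ≤-Reasoning

  weight-subsets : ∀ A → 2 ^ m * (⟦ ∣ A ∣ + m ≤? n ⟧ * ∑ (subsets n) (λ S → sub S A)) ≤ 2 ^ n
  weight-subsets A = ⟦⟧-≤ (∣ A ∣ + m ≤? n) (2 ^ m) (∑ (subsets n) (λ S → sub S A)) λ ≤n → begin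
    2 ^ m * ∑ (subsets n) (λ S → sub S A)        ≡⟨ cong (2 ^ m *_) (∑-subsets-of A) ⟩
    2 ^ m * 2 ^ ∣ A ∣                            ≡⟨ *-comm (2 ^ m) (2 ^ ∣ A ∣) ⟩
    2 ^ ∣ A ∣ * 2 ^ m                            ≡⟨ ^-distribˡ-+-* 2 ∣ A ∣ m ⟨
    2 ^ (∣ A ∣ + m)                              ≤⟨ ^-monoʳ-≤ 2 ≤n ⟩
    2 ^ n ∎
    where open ≤-Reasoning

  total-weight : ∀ A → 2 ^ m * ∑ (subsets n) (weight A) ≤ 2 * 2 ^ n
  total-weight A = begin
    2 ^ m * ∑ (subsets n) (weight A)
      ≡⟨ cong (2 ^ m *_) (∑-distrib-+ (subsets n) (λ S → x * sub A S) (λ S → y * sub S A)) ⟩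
    2 ^ m * (∑ (subsets n) (λ S → x * sub A S) + ∑ (subsets n) (λ S → y * sub S A))
      ≡⟨ cong₂ (λ u v → 2 ^ m * (u + v)) (∑-distribˡ-* (subsets n) x (sub A)) (∑-distribˡ-* (subsets n) y (λ S → sub S A)) ⟩
    2 ^ m * (x * ∑ (subsets n) (sub A) + y * ∑ (subsets n) (λ S → sub S A))
      ≡⟨ *-distribˡ-+ (2 ^ m) _ _ ⟩
    2 ^ m * (x * ∑ (subsets n) (sub A)) + 2 ^ m * (y * ∑ (subsets n) (λ S → sub S A))
      ≤⟨ +-mono-≤ (weight-supersets A) (weight-subsets A) ⟩
    2 ^ n + 2 ^ n
      ≡⟨ cong (2 ^ n +_) (+-identityʳ (2 ^ n)) ⟨
    2 * 2 ^ n ∎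
    where
    open ≤-Reasoning
    x = ⟦ m ≤? ∣ A ∣ ⟧
    y = ⟦ ∣ A ∣ + m ≤? n ⟧

  -- Each of the 2 ^ n sets receives weight at least 1, while a member gives out at most 2 ^ (n - m)
  -- for each of the two kinds of witness.
  2^m≤2∣𝓕∣ : 2 ^ m ≤ length 𝓕 * 2
  2^m≤2∣𝓕∣ = *-cancelʳ-≤ _ _ (2 ^ n) {{m^n≢0 2 n}} (begin
    2 ^ m * 2 ^ n
      ≡⟨ cong (2 ^ m *_) (length-subsets n) ⟨
    2 ^ m * length (subsets n)
      ≡⟨ cong (2 ^ m *_) (length≡∑1 (subsets n)) ⟩
    2 ^ m * ∑ (subsets n) (λ _ → 1)
      ≤⟨ *-monoʳ-≤ (2 ^ m) (∑-mono (subsets n) (λ {S} _ → covered S)) ⟩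
    2 ^ m * ∑ (subsets n) (λ S → ∑ 𝓕 (λ A → weight A S))
      ≡⟨ cong (2 ^ m *_) (∑-swap (subsets n) 𝓕 (λ S A → weight A S)) ⟩
    2 ^ m * ∑ 𝓕 (λ A → ∑ (subsets n) (weight A))
      ≡⟨ ∑-distribˡ-* 𝓕 (2 ^ m) (λ A → ∑ (subsets n) (weight A)) ⟨
    ∑ 𝓕 (λ A → 2 ^ m * ∑ (subsets n) (weight A))
      ≤⟨ ∑-mono 𝓕 (λ {A} _ → total-weight A) ⟩
    ∑ 𝓕 (λ _ → 2 * 2 ^ n)
      ≡⟨ ∑-const 𝓕 (2 * 2 ^ n) ⟩
    length 𝓕 * (2 * 2 ^ n)
      ≡⟨ *-assoc (length 𝓕) 2 (2 ^ n) ⟨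
    length 𝓕 * 2 * 2 ^ n ∎)
    where
    open ≤-Reasoning
    covered : ∀ S → 1 ≤ ∑ 𝓕 (λ A → weight A S)
    covered S with A , A∈ , wit ← witness S =
      ≤-trans (witness-weight wit) (∑-∈-≤ (λ A → weight A S) A∈)

-- Complements and chains of suffixes.

⊆∧≢⇒⊂ : ∀ {n} {p q : Subset n} → p ⊆ q → p ≢ q → p ⊂ q
⊆∧≢⇒⊂ {p = p} {q} p⊆q p≢q with Fin.any? (λ x → (x ∈? q) ×-dec ¬? (x ∈? p))
... | yes extra = p⊆q , extra
... | no none   = ⊥-elim (p≢q (⊆-antisym p⊆q q⊆p))
  where
  q⊆p : q ⊆ p
  q⊆p {x} x∈q with x ∈? p
  ... | yes x∈p = x∈p
  ... | no x∉p  = ⊥-elim (none (x , x∈q , x∉p))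

∁-involutive : ∀ {n} (p : Subset n) → ∁ (∁ p) ≡ p
∁-involutive p = trans (sym (Vec.map-∘ not not p)) (trans (Vec.map-cong not-involutive p) (Vec.map-id p))

-- Complementation reverses inclusion, so the construction below a set also serves above it.
Down⇒Up-∁ : ∀ {n} {𝓛 : List (Subset n)} j {A} → Down 𝓛 j A → Up (map ∁ 𝓛) j (∁ A)
Down⇒Up-∁ zero    _                     = tt
Down⇒Up-∁ (suc j) (B , B∈ , B⊂A , down) = ∁ B , ∈-map⁺ ∁ B∈ , p⊂q⇒∁p⊃∁q B⊂A , Down⇒Up-∁ j down

module SuffixChains {N n : ℕ} (ι : Fin N → Fin n) (ι-injective : ∀ {x y} → ι x ≡ ι y → x ≡ y) where

  entries : List (Fin N) → Subset n
  entries []      = Sub.⊥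
  entries (x ∷ v) = ⁅ ι x ⁆ ∪ entries v

  suffixSets : List (Fin N) → List (Subset n)
  suffixSets []      = Sub.⊥ ∷ []
  suffixSets (x ∷ v) = entries (x ∷ v) ∷ suffixSets v

  length-suffixSets : ∀ v → length (suffixSets v) ≡ suc (length v)
  length-suffixSets []      = refl
  length-suffixSets (x ∷ v) = cong suc (length-suffixSets v)

  entries∈suffixSets : ∀ v → entries v ∈ suffixSets v
  entries∈suffixSets []      = here refl
  entries∈suffixSets (x ∷ v) = here refl

  -- The target `S` is left free: it is the given set for traces, and the full set without `ι x` in
  -- `∉entries`.
  Inside⇒entries⊆ : ∀ v {T S} → Inside v T → (∀ {x} → x Sub.∈ T → ι x Sub.∈ S) → entries v ⊆ S
  Inside⇒entries⊆ []      _ _ h = ⊥-elim (∉⊥ h)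
  Inside⇒entries⊆ (x ∷ v) {T} (x∈T , ins) into h with x∈p∪q⁻ ⁅ ι x ⁆ (entries v) h
  ... | inj₁ y∈⁅x⁆ rewrite x∈⁅y⁆⇒x≡y (ι x) y∈⁅x⁆ = into x∈T
  ... | inj₂ y∈v = Inside⇒entries⊆ v ins (into ∘ p─q⊆p T ⁅ x ⁆) y∈v

  ∉entries : ∀ v {T} x → Inside v (T - x) → ι x Sub.∉ entries v
  ∉entries v {T} x ins ιx∈ = x∉p-x Sub.⊤ (ι x) (Inside⇒entries⊆ v ins avoid ιx∈)
    where
    avoid : ∀ {y} → y Sub.∈ T - x → ι y Sub.∈ Sub.⊤ - ι x
    avoid y∈ = x∈p∧x≢y⇒x∈p-y ∈⊤ λ ιy≡ιx →
      x∉p-x T x (subst (Sub._∈ T - x) (ι-injective ιy≡ιx) y∈)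

  -- Each inclusion of suffix sets is strict because the tail is drawn from `T - x` and `ι` is
  -- injective.
  Inside⇒Down : ∀ v {T} → Inside v T → Down (suffixSets v) (length v) (entries v)
  Inside⇒Down []      _         = tt
  Inside⇒Down (x ∷ v) {T} (_ , ins) =
    entries v , there (entries∈suffixSets v) ,
    (q⊆p∪q ⁅ ι x ⁆ (entries v) , ι x , p⊆p∪q (entries v) (x∈⁅x⁆ (ι x)) , ∉entries v {T} x ins) ,
    Down-⊆ there (length v) (Inside⇒Down v ins)

  -- The part of `S` in the core, pulled back along `ι`.
  trace : Subset n → Subset N
  trace S = Vec.tabulate (λ x → Vec.lookup S (ι x))

  ∈-trace⁻ : ∀ S {x} → x Sub.∈ trace S → ι x Sub.∈ S
  ∈-trace⁻ S {x} h = lookup⇒[]= (ι x) S (trans (sym (lookup∘tabulate _ x)) ([]=⇒lookup h))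

  trace-∁ : ∀ S → trace (∁ S) ≡ ∁ (trace S)
  trace-∁ S = trans (tabulate-cong (λ x → lookup-map (ι x) not S)) (tabulate-∘ not _)

  ∣trace∣+∣trace-∁∣ : ∀ S → ∣ trace S ∣ + ∣ trace (∁ S) ∣ ≡ N
  ∣trace∣+∣trace-∁∣ S = trans
    (cong (∣ trace S ∣ +_) (trans (cong ∣_∣ (trace-∁ S)) (∣∁p∣≡n∸∣p∣ (trace S))))
    (m+[n∸m]≡n (∣p∣≤n (trace S)))

  -- Since `S` is not in the family, its inclusion of `entries v` is strict; this makes `entries v`
  -- one more set of the chain.
  Inside-trace⇒Down : ∀ v {S 𝓛} → (∀ {A} → A ∈ suffixSets v → A ∈ 𝓛) → S ∉ 𝓛 →
                      Inside v (trace S) → Down 𝓛 (suc (length v)) S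
  Inside-trace⇒Down v {S} ⊆𝓛 S∉ ins =
    entries v , ⊆𝓛 (entries∈suffixSets v) ,
    ⊆∧≢⇒⊂ (Inside⇒entries⊆ v ins (∈-trace⁻ S)) (λ { refl → S∉ (⊆𝓛 (entries∈suffixSets v)) }) ,
    Down-⊆ ⊆𝓛 (length v) (Inside⇒Down v ins)

-- Assembly of the oversaturated family.

length-concatMap-≤ : ∀ (f : A → List B) c xs → (∀ {x} → x ∈ xs → length (f x) ≤ c) →
                     length (concatMap f xs) ≤ length xs * c
length-concatMap-≤ f c []       _ = z≤n
length-concatMap-≤ f c (x ∷ xs) h = ≤-trans (≤-reflexive (length-++ (f x)))
  (+-mono-≤ (h (here refl)) (length-concatMap-≤ f c xs (h ∘ there)))

0<[κ[2+κ]]^a : ∀ κ a → a ≤ κ → 0 < (κ * (2 + κ)) ^ a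
0<[κ[2+κ]]^a κ       zero    _ = z<s
0<[κ[2+κ]]^a (suc κ) (suc a) _ = m^n>0 (suc κ * (2 + suc κ)) (suc a)

-- Here `M` plays the part of 2 ^ (κ / 2), 1 / `suc r` is the popularity threshold, and `i` is the
-- number of greedy rounds that exhausts up to 2 ^ N traces.
module Construction (κ M r i N n : ℕ) (1+r≡16M : suc r ≡ 16 * M) (i≡ : i ≡ suc r * suc N)
                    (N≡ : N ≡ κ * (2 + κ)) (2^κ≤M² : 2 ^ κ ≤ M * M) (N≤n : N ≤ n) where

  open SuffixChains {N} {n} (λ x → inject≤ x N≤n) (Fin.inject≤-injective N≤n N≤n _ _)

  -- A condition on the size of the trace only: `sequence-lengths` supplies it, and `count-inside-∸`
  -- turns it into popularity.
  Rich : ℕ → Subset N → Set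
  Rich a T = N ^ a ≤ suc r * (∣ T ∣ ∸ κ) ^ a

  rich? : ∀ a T → Dec (Rich a T)
  rich? a T = N ^ a ≤? suc r * (∣ T ∣ ∸ κ) ^ a

  hitting-sequences : ∀ a → a ≤ κ → ∃[ vs ] length vs ≤ i × (∀ {v} → v ∈ vs → v ∈ sequences N a) ×
                      (∀ {T} → Rich a T → ∃[ v ] v ∈ vs × Inside v T)
  hitting-sequences a a≤κ =
    let vs , len , vs⊆ , hits = cover N i (filter (rich? a) (subsets N)) i≡
          (≤-trans (length-filter (rich? a) (subsets N)) (≤-reflexive (length-subsets N)))
          (popular ∘ proj₂ ∘ ∈-filter⁻ (rich? a) {xs = subsets N})
    in vs , len , vs⊆ , λ {T} rich → hits (∈-filter⁺ (rich? a) (∈-subsets T) rich)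
    where
    open GreedyCover inside? (sequences N a)
      (subst (0 <_) (sym (trans (length-sequences N a) (cong (_^ a) N≡))) (0<[κ[2+κ]]^a κ a a≤κ)) r
    popular : ∀ {T} → Rich a T → Popular T
    popular {T} rich = ≤-trans (≤-reflexive (length-sequences N a))
      (≤-trans rich (*-monoʳ-≤ (suc r) (count-inside-∸ N κ a T a≤κ)))

  -- Quantifying over every larger family `𝓜` lets the levels be united afterwards.
  level : ∀ a → a ≤ κ → ∃[ 𝓛 ] length 𝓛 ≤ i * suc κ ×
          (∀ {𝓜 S} → (∀ {A} → A ∈ 𝓛 → A ∈ 𝓜) → S ∉ 𝓜 → Rich a (trace S) → Down 𝓜 (suc a) S)
  level a a≤κ with vs , len , vs⊆ , hits ← hitting-sequences a a≤κ =
    concatMap suffixSets vs ,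
    ≤-trans (length-concatMap-≤ suffixSets (suc κ) vs short) (*-monoˡ-≤ (suc κ) len) ,
    down
    where
    short : ∀ {v} → v ∈ vs → length (suffixSets v) ≤ suc κ
    short {v} v∈ rewrite length-suffixSets v | ∈-sequences⇒length N a (vs⊆ v∈) = s≤s a≤κ
    down : ∀ {𝓜 S} → (∀ {A} → A ∈ concatMap suffixSets vs → A ∈ 𝓜) → S ∉ 𝓜 →
           Rich a (trace S) → Down 𝓜 (suc a) S
    down {𝓜} {S} ⊆𝓜 S∉ rich with v , v∈ , ins ← hits rich =
      subst (λ z → Down 𝓜 (suc z) S) (∈-sequences⇒length N a (vs⊆ v∈))
        (Inside-trace⇒Down v (λ A∈ → ⊆𝓜 (∈-concatMap⁺ suffixSets (lose v∈ A∈))) S∉ ins)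

  levels : ∀ j → j ≤ suc κ → ∃[ 𝓛 ] length 𝓛 ≤ j * (i * suc κ) ×
           (∀ {𝓜 S} a → a < j → (∀ {A} → A ∈ 𝓛 → A ∈ 𝓜) → S ∉ 𝓜 → Rich a (trace S) → Down 𝓜 (suc a) S)
  levels zero    _    = [] , z≤n , λ _ ()
  levels (suc j) j<1+κ
    with 𝓛₁ , len₁ , down₁ ← level j (≤-pred j<1+κ)
    with 𝓛₂ , len₂ , down₂ ← levels j (<⇒≤ j<1+κ) =
    𝓛₁ ++ 𝓛₂ , ≤-trans (≤-reflexive (length-++ 𝓛₁)) (+-mono-≤ len₁ len₂) , down
    where
    down : ∀ {𝓜 S} a → a < suc j → (∀ {A} → A ∈ 𝓛₁ ++ 𝓛₂ → A ∈ 𝓜) → S ∉ 𝓜 →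
           Rich a (trace S) → Down 𝓜 (suc a) S
    down a a<1+j ⊆𝓜 with m≤n⇒m<n∨m≡n (≤-pred a<1+j)
    ... | inj₁ a<j  = down₂ a a<j (⊆𝓜 ∘ ∈-++⁺ʳ 𝓛₁)
    ... | inj₂ refl = down₁ (⊆𝓜 ∘ ∈-++⁺ˡ)

  rich-lengths : ∀ S → ∃[ a ] ∃[ b ] a ≤ κ × b ≤ κ × κ ≤ suc (a + b) ×
                 Rich a (trace S) × Rich b (trace (∁ S))
  rich-lengths S =
    let a , b , a≤κ , b≤κ , κ≤ , rich-a , rich-b =
          sequence-lengths κ M (∣ trace S ∣) (∣ trace (∁ S) ∣) 2^κ≤M² (trans (∣trace∣+∣trace-∁∣ S) N≡)
    in a , b , a≤κ , b≤κ , κ≤ , rich a (trace S) rich-a , rich b (trace (∁ S)) rich-b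
    where
    rich : ∀ a T → (κ * (2 + κ)) ^ a ≤ 16 * M * (∣ T ∣ ∸ κ) ^ a → Rich a T
    rich a T = subst₂ (λ N′ R → N′ ^ a ≤ R * (∣ T ∣ ∸ κ) ^ a) (sym N≡) (sym 1+r≡16M)

  oversaturated-family : ∃[ 𝓕 ] OsatFamily n (suc κ) 𝓕 × length 𝓕 ≤ 2 * (suc κ * (i * suc κ))
  oversaturated-family with 𝓛 , len , down ← levels (suc κ) ≤-refl =
    𝓕 , (Unique.deduplicate-! _≟ˢ_ 𝓖 , osat) , size
    where
    𝓖 = 𝓛 ++ map ∁ 𝓛
    𝓕 = deduplicate _≟ˢ_ 𝓖

    size : length 𝓕 ≤ 2 * (suc κ * (i * suc κ))
    size = begin
      length 𝓕                        ≤⟨ length-deduplicate _≟ˢ_ 𝓖 ⟩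
      length 𝓖                        ≡⟨ length-++ 𝓛 ⟩
      length 𝓛 + length (map ∁ 𝓛)     ≡⟨ cong (length 𝓛 +_) (trans (length-map ∁ 𝓛) (sym (+-identityʳ _))) ⟩
      2 * length 𝓛                    ≤⟨ *-monoʳ-≤ 2 len ⟩
      2 * (suc κ * (i * suc κ)) ∎
      where open ≤-Reasoning

    osat : Oversaturated (suc κ) 𝓕
    osat S S∉𝓕 =
      let a , b , a≤κ , b≤κ , κ≤1+a+b , rich-a , rich-b = rich-lengths S
      -- There are a + 1 members below `S` and b + 1 above. Of the latter only κ - a ≤ b + 1 are
      -- kept, so that with `S` the chain has exactly κ + 2 sets.
      in subst (λ k → chainCount k 𝓕 < chainCount k (S ∷ 𝓕)) (trans (+-suc (κ ∸ a) a) (cong suc (m∸n+n≡m a≤κ)))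
           (Down-Up⇒chainCount-< 𝓕 S (suc a) (κ ∸ a) (below a a≤κ rich-a)
             (Up-shorten (m≤n+o⇒m∸n≤o κ a (≤-trans κ≤1+a+b (≤-reflexive (sym (+-suc a b)))))
               (above b b≤κ rich-b)))
      where
      S∉𝓛 : S ∉ 𝓛
      S∉𝓛 h = S∉𝓕 (∈-deduplicate⁺ _≟ˢ_ (∈-++⁺ˡ h))
      ∁S∉𝓛 : ∁ S ∉ 𝓛
      ∁S∉𝓛 h = S∉𝓕 (∈-deduplicate⁺ _≟ˢ_ (∈-++⁺ʳ 𝓛 (subst (_∈ map ∁ 𝓛) (∁-involutive S) (∈-map⁺ ∁ h))))
      below : ∀ a → a ≤ κ → Rich a (trace S) → Down 𝓕 (suc a) S
      below a a≤κ rich = Down-⊆ (λ h → ∈-deduplicate⁺ _≟ˢ_ (∈-++⁺ˡ h)) (suc a)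
        (down a (s≤s a≤κ) (λ h → h) S∉𝓛 rich)
      above : ∀ b → b ≤ κ → Rich b (trace (∁ S)) → Up 𝓕 (suc b) S
      above b b≤κ rich = Up-⊆ (λ h → ∈-deduplicate⁺ _≟ˢ_ (∈-++⁺ʳ 𝓛 h)) (suc b)
        (subst (Up (map ∁ 𝓛) (suc b)) (∁-involutive S)
          (Down⇒Up-∁ (suc b) (down b (s≤s b≤κ) (λ h → h) ∁S∉𝓛 rich)))

-- Explicit bounds and the exponent 1 / 2.

-- Squaring expresses 2 ^ (k / 2) without roots. The construction yields k⁴, which is at most k⁵ as
-- k ≥ 1.
square-bound : ∀ {ℓ M P} k .{{_ : NonZero k}} → ℓ ≤ 32 * M * (k * k * k * k) → M * M ≤ P →
               ℓ ^ 2 ≤ (32 * k ^ 5) ^ 2 * P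
square-bound {ℓ} {M} {P} k ℓ≤ M²≤P = begin
  ℓ ^ 2                              ≤⟨ ^-monoˡ-≤ 2 ℓ≤ ⟩
  (32 * M * x) ^ 2                   ≡⟨ lem₁ M x ⟩
  (32 * x) ^ 2 * (M * M)             ≤⟨ *-mono-≤ (^-monoˡ-≤ 2 (*-monoʳ-≤ 32 x≤k⁵)) M²≤P ⟩
  (32 * k ^ 5) ^ 2 * P ∎
  where
  open ≤-Reasoning
  x = k * k * k * k
  lem₁ : ∀ M x → 32 * M * x * (32 * M * x * 1) ≡ 32 * x * (32 * x * 1) * (M * M)
  lem₁ = solve-∀
  lem₂ : ∀ k → k * k * k * k * k ≡ k * (k * (k * (k * (k * 1))))
  lem₂ = solve-∀
  x≤k⁵ : x ≤ k ^ 5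
  x≤k⁵ = ≤-trans (m≤m*n x k) (≤-reflexive (lem₂ k))

upper-bound : ∀ κ n → suc κ * suc κ + suc κ ≤ n →
              ∃[ 𝓕 ] OsatFamily n (suc κ) 𝓕 × length 𝓕 ^ 2 ≤ (32 * suc κ ^ 5) ^ 2 * 2 ^ suc κ
upper-bound κ n k²+k≤n =
  let 𝓕 , osat , size = Construction.oversaturated-family κ M r (suc r * suc N) N n
        1+r≡16M refl refl 2^κ≤M² N≤n
  in 𝓕 , osat , square-bound {M = M} (suc κ) (≤-trans size (≤-reflexive size≡)) M²≤2^k
  where
  -- Rounding up places M² between 2 ^ κ and 2 ^ (κ + 1).
  h = ⌈ κ /2⌉
  M = 2 ^ h
  N = κ * (2 + κ)
  r = pred (16 * M)
  1+r≡16M : suc r ≡ 16 * M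
  1+r≡16M = suc-pred (16 * M) {{m*n≢0 16 M {{_}} {{m^n≢0 2 h}}}}
  2^κ≤M² : 2 ^ κ ≤ M * M
  2^κ≤M² = subst (2 ^ κ ≤_) (^-distribˡ-+-* 2 h h) (^-monoʳ-≤ 2
    (≤-trans (≤-reflexive (sym (⌊n/2⌋+⌈n/2⌉≡n κ))) (+-monoˡ-≤ h (⌊n/2⌋≤⌈n/2⌉ κ))))
  M²≤2^k : M * M ≤ 2 ^ suc κ
  M²≤2^k = subst (_≤ 2 ^ suc κ) (^-distribˡ-+-* 2 h h) (^-monoʳ-≤ 2
    (≤-trans (+-monoʳ-≤ h (⌊n/2⌋≤⌈n/2⌉ (suc κ))) (≤-reflexive (⌊n/2⌋+⌈n/2⌉≡n (suc κ)))))
  lem₁ : ∀ κ → κ * (2 + κ) + (2 + κ) ≡ suc κ * suc κ + suc κ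
  lem₁ = solve-∀
  N≤n : N ≤ n
  N≤n = ≤-trans (≤-trans (m≤m+n N (2 + κ)) (≤-reflexive (lem₁ κ))) k²+k≤n
  -- Since N + 1 = k², the size bound 2k · (16M · k²) · k equals 32 · M · k⁴.
  lem₂ : ∀ κ R → 2 * (suc κ * (R * suc (κ * (2 + κ)) * suc κ)) ≡ 2 * R * (suc κ * suc κ * suc κ * suc κ)
  lem₂ = solve-∀
  size≡ : 2 * (suc κ * (suc r * suc N * suc κ)) ≡ 32 * M * (suc κ * suc κ * suc κ * suc κ)
  size≡ = trans (lem₂ κ (suc r)) (cong (_* (suc κ * suc κ * suc κ * suc κ))
    (trans (cong (2 *_) 1+r≡16M) (sym (*-assoc 2 16 M))))

lower-bound : ∀ κ n (𝓕 : List (Subset n)) → suc κ ≤ n → Oversaturated (suc κ) 𝓕 →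
              2 ^ suc κ ≤ 16 * length 𝓕 ^ 2
lower-bound κ n 𝓕 k≤n osat = begin
  2 ^ suc κ                          ≤⟨ ^-monoʳ-≤ 2 (s≤s κ≤1+2m) ⟩
  2 ^ (2 + (m + m))                  ≡⟨ cong (λ z → 2 * (2 * z)) (^-distribˡ-+-* 2 m m) ⟩
  2 * (2 * (2 ^ m * 2 ^ m))          ≤⟨ *-monoʳ-≤ 2 (*-monoʳ-≤ 2 (*-mono-≤ 2^m≤ 2^m≤)) ⟩
  2 * (2 * (ℓ * 2 * (ℓ * 2)))        ≡⟨ lem ℓ ⟩
  16 * ℓ ^ 2 ∎
  where
  open ≤-Reasoning
  ℓ = length 𝓕
  -- The largest m with 2m < k. Rounding costs a factor 4, and squaring 2 ^ m ≤ 2ℓ another 4, which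
  -- gives the 16.
  m = ⌊ κ /2⌋
  2m≤κ : m + m ≤ κ
  2m≤κ = ≤-trans (+-monoʳ-≤ m (⌊n/2⌋≤⌈n/2⌉ κ)) (≤-reflexive (⌊n/2⌋+⌈n/2⌉≡n κ))
  κ≤1+2m : κ ≤ suc (m + m)
  κ≤1+2m = ≤-trans (≤-reflexive (sym (⌊n/2⌋+⌈n/2⌉≡n κ)))
    (≤-trans (+-monoʳ-≤ m (⌊n/2⌋-mono (n≤1+n (suc κ)))) (≤-reflexive (+-suc m m)))
  2^m≤ : 2 ^ m ≤ ℓ * 2
  2^m≤ = LowerBound.2^m≤2∣𝓕∣ {k = suc κ} {m = m} 𝓕 osat (s≤s 2m≤κ) (≤-trans 2m≤κ (≤-trans (n≤1+n κ) k≤n))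
  lem : ∀ ℓ → 2 * (2 * (ℓ * 2 * (ℓ * 2))) ≡ 16 * (ℓ * (ℓ * 1))
  lem = solve-∀

n≤2^n : ∀ n → n ≤ 2 ^ n
n≤2^n zero    = z≤n
n≤2^n (suc n) = +-mono-≤ (m^n>0 2 n) (≤-trans (n≤2^n n) (≤-reflexive (sym (+-identityʳ _))))

n≤3⌊n/2⌋ : ∀ n → 2 ≤ n → n ≤ 3 * ⌊ n /2⌋
n≤3⌊n/2⌋ (suc zero) (s≤s ())
n≤3⌊n/2⌋ (suc (suc zero))       _ = s≤s (s≤s z≤n)
n≤3⌊n/2⌋ (suc (suc (suc zero))) _ = ≤-refl
n≤3⌊n/2⌋ (suc (suc n@(suc (suc _)))) _ = begin
  2 + n                ≤⟨ n≤1+n _ ⟩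
  3 + n                ≤⟨ +-monoʳ-≤ 3 (n≤3⌊n/2⌋ n (s≤s (s≤s z≤n))) ⟩
  3 + 3 * ⌊ n /2⌋      ≡⟨ *-suc 3 ⌊ n /2⌋ ⟨
  3 * suc ⌊ n /2⌋ ∎
  where open ≤-Reasoning

-- With j = ⌊k / 2⌋ and k ≤ 3j, one factor 2 ^ j absorbs degree d by induction and the other absorbs
-- the remaining factor j.
exponential-dominates : ∀ d c → ∃[ K ] ∀ k → K ≤ k → c * k ^ d ≤ 2 ^ k
exponential-dominates zero c = c , λ k c≤k →
  ≤-trans (≤-reflexive (*-identityʳ c)) (≤-trans c≤k (n≤2^n k))
exponential-dominates (suc d) c with K , dom ← exponential-dominates d (c * 3 ^ suc d) =
  2 + (K + K) , bound
  where
  open ≤-Reasoning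
  lem : ∀ c t j x → c * (t * (j * x)) ≡ c * t * x * j
  lem = solve-∀
  bound : ∀ k → 2 + (K + K) ≤ k → c * k ^ suc d ≤ 2 ^ k
  bound k K≤k = begin
    c * k ^ suc d                    ≤⟨ *-monoʳ-≤ c (^-monoˡ-≤ (suc d) (n≤3⌊n/2⌋ k (≤-trans (m≤m+n 2 _) K≤k))) ⟩
    c * (3 * j) ^ suc d              ≡⟨ cong (c *_) (^-distribʳ-* (suc d) 3 j) ⟩
    c * (3 ^ suc d * j ^ suc d)      ≡⟨ lem c (3 ^ suc d) j (j ^ d) ⟩
    c * 3 ^ suc d * j ^ d * j        ≤⟨ *-mono-≤ (dom j K≤j) (n≤2^n j) ⟩
    2 ^ j * 2 ^ j                    ≡⟨ ^-distribˡ-+-* 2 j j ⟨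
    2 ^ (j + j)                      ≤⟨ ^-monoʳ-≤ 2 (≤-trans (+-monoʳ-≤ j (⌊n/2⌋≤⌈n/2⌉ k)) (≤-reflexive (⌊n/2⌋+⌈n/2⌉≡n k))) ⟩
    2 ^ k ∎
    where
    j = ⌊ k /2⌋
    K≤j : K ≤ j
    K≤j = ≤-trans (≤-reflexive (n≡⌊n+n/2⌋ K)) (⌊n/2⌋-mono (≤-trans (m≤n+m (K + K) 2) K≤k))

-- This is ℓ ≤ 2 ^ ((1 / 2 + 1 / q) k) cleared of fractions. After raising to the power q, the
-- polynomial factor is a square of something at most 2 ^ k.
exponent-upper : ∀ q k ℓ → ℓ ^ 2 ≤ (32 * k ^ 5) ^ 2 * 2 ^ k → 32 ^ q * k ^ (5 * q) ≤ 2 ^ k →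
                 ℓ ^ (2 * q) ≤ 2 ^ ((q + 2) * k)
exponent-upper q k ℓ ℓ²≤ poly≤ = begin
  ℓ ^ (2 * q)                        ≡⟨ ^-*-assoc ℓ 2 q ⟨
  (ℓ ^ 2) ^ q                        ≤⟨ ^-monoˡ-≤ q ℓ²≤ ⟩
  (y ^ 2 * 2 ^ k) ^ q                ≡⟨ ^-distribʳ-* q (y ^ 2) (2 ^ k) ⟩
  (y ^ 2) ^ q * (2 ^ k) ^ q          ≡⟨ cong₂ _*_ swap (trans (^-*-assoc 2 k q) (cong (2 ^_) (*-comm k q))) ⟩
  (y ^ q) ^ 2 * 2 ^ (q * k)          ≤⟨ *-monoˡ-≤ (2 ^ (q * k)) (^-monoˡ-≤ 2 y^q≤) ⟩
  (2 ^ k) ^ 2 * 2 ^ (q * k)          ≡⟨ cong (_* 2 ^ (q * k)) (^-*-assoc 2 k 2) ⟩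
  2 ^ (k * 2) * 2 ^ (q * k)          ≡⟨ ^-distribˡ-+-* 2 (k * 2) (q * k) ⟨
  2 ^ (k * 2 + q * k)                ≡⟨ cong (2 ^_) (lem q k) ⟩
  2 ^ ((q + 2) * k) ∎
  where
  open ≤-Reasoning
  y = 32 * k ^ 5
  swap : (y ^ 2) ^ q ≡ (y ^ q) ^ 2
  swap = trans (^-*-assoc y 2 q) (trans (cong (y ^_) (*-comm 2 q)) (sym (^-*-assoc y q 2)))
  y^q≤ : y ^ q ≤ 2 ^ k
  y^q≤ = ≤-trans (≤-reflexive (trans (^-distribʳ-* q 32 (k ^ 5)) (cong (32 ^ q *_) (^-*-assoc k 5 q)))) poly≤
  lem : ∀ q k → k * 2 + q * k ≡ (q + 2) * k
  lem = solve-∀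

-- The constant becomes 16 ^ q = 2 ^ (4q) ≤ 2 ^ (2k), which accounts for the loss of 2 in `q ∸ 2`.
-- For q ≤ 1 the truncated exponent is 0 and ℓ ≥ 1 suffices.
exponent-lower : ∀ q k ℓ → 2 * q ≤ k → 2 ^ k ≤ 16 * ℓ ^ 2 → 2 ^ ((q ∸ 2) * k) ≤ ℓ ^ (2 * q)
exponent-lower q k zero _ h = ⊥-elim (<⇒≱ (m^n>0 2 k) h)
exponent-lower zero k ℓ@(suc _) _ _ = m^n>0 ℓ 0
exponent-lower (suc zero) k ℓ@(suc _) _ _ = m^n>0 ℓ 2
exponent-lower q@(suc (suc p)) k ℓ@(suc _) 2q≤k h = *-cancelˡ-≤ (2 ^ (4 * q)) {{m^n≢0 2 (4 * q)}} (begin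
  2 ^ (4 * q) * 2 ^ (p * k)       ≡⟨ ^-distribˡ-+-* 2 (4 * q) (p * k) ⟨
  2 ^ (4 * q + p * k)             ≤⟨ ^-monoʳ-≤ 2 exponents ⟩
  2 ^ (k * q)                     ≡⟨ ^-*-assoc 2 k q ⟨
  (2 ^ k) ^ q                     ≤⟨ ^-monoˡ-≤ q h ⟩
  (16 * ℓ ^ 2) ^ q                ≡⟨ ^-distribʳ-* q 16 (ℓ ^ 2) ⟩
  16 ^ q * (ℓ ^ 2) ^ q            ≡⟨ cong₂ _*_ (^-*-assoc 2 4 q) (^-*-assoc ℓ 2 q) ⟩
  2 ^ (4 * q) * ℓ ^ (2 * q) ∎)
  where
  open ≤-Reasoning
  lem₁ : ∀ q x → 4 * q + x ≡ 2 * (2 * q) + x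
  lem₁ = solve-∀
  lem₂ : ∀ p k → 2 * k + p * k ≡ k * (2 + p)
  lem₂ = solve-∀
  exponents : 4 * q + p * k ≤ k * q
  exponents = begin
    4 * q + p * k         ≡⟨ lem₁ q (p * k) ⟩
    2 * (2 * q) + p * k   ≤⟨ +-monoˡ-≤ (p * k) (*-monoʳ-≤ 2 2q≤k) ⟩
    2 * k + p * k         ≡⟨ lem₂ p k ⟩
    k * q ∎

theorem1p6 : (∃[ C ] ∀ (k : ℕ) → 1 ≤ k → ∀ (n : ℕ) → k * k + k ≤ n →
    Σ (List (Subset n)) λ 𝓕 → OsatFamily n k 𝓕 ×
    length 𝓕 ^ 2 ≤ (C * k ^ 5) ^ 2 * 2 ^ k)
    × (∀ (q : ℕ) → 1 ≤ q → ∃[ K ] ∀ (k : ℕ) → K ≤ k → ∃[ N ] ∀ (n : ℕ) → N ≤ n →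
    ((∀ (𝓕 : List (Subset n)) → OsatFamily n k 𝓕 →
    2 ^ ((q ∸ 2) * k) ≤ length 𝓕 ^ (2 * q))
    × Σ (List (Subset n)) λ 𝓕 → OsatFamily n k 𝓕 ×
    length 𝓕 ^ (2 * q) ≤ 2 ^ ((q + 2) * k)))
theorem1p6 = (32 , λ { (suc κ) _ n k²+k≤n → upper-bound κ n k²+k≤n }) , osat-asymptotics
  where
  osat-asymptotics : ∀ (q : ℕ) → 1 ≤ q → ∃[ K ] ∀ (k : ℕ) → K ≤ k → ∃[ N ] ∀ (n : ℕ) → N ≤ n →
    ((∀ (𝓕 : List (Subset n)) → OsatFamily n k 𝓕 → 2 ^ ((q ∸ 2) * k) ≤ length 𝓕 ^ (2 * q))
    × Σ (List (Subset n)) λ 𝓕 → OsatFamily n k 𝓕 × length 𝓕 ^ (2 * q) ≤ 2 ^ ((q + 2) * k))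
  osat-asymptotics q 1≤q with K , dom ← exponential-dominates (5 * q) (32 ^ q) =
    -- `K` absorbs the polynomial factor, 2q serves `exponent-lower`, and the successor makes k
    -- positive.
    suc (K + 2 * q) , λ
    { (suc κ) K≤k → suc κ * suc κ + suc κ , λ n k²+k≤n →
        (λ 𝓕 (_ , osat) → exponent-lower q (suc κ) (length 𝓕)
          (≤-trans (m≤n+m (2 * q) (suc K)) K≤k)
          (lower-bound κ n 𝓕 (≤-trans (m≤n+m (suc κ) (suc κ * suc κ)) k²+k≤n) osat)) ,
        (let 𝓕 , osat , size = upper-bound κ n k²+k≤n
         in 𝓕 , osat , exponent-upper q (suc κ) (length 𝓕) size
              (dom (suc κ) (≤-trans (≤-trans (m≤m+n K (2 * q)) (n≤1+n _)) K≤k))) }
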